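{- Let $G$ be an oriented unicyclic graph on $n\ge 2$ vertices with cycle $C$ and non-zero edge weights in $\mathbb{C}\setminus\mathbb{R}^-$, and let $i,j$ be vertices of $G$. Let $\gamma'_{i\to j}$ and $\gamma_{i\to j}$ be any two walks from vertex $i$ to vertex $j$ in the underlying graph $G_u$. If $wt(C)\in\mathbb{C}\setminus\mathbb{R}^-$, then $$\frac{wt(\gamma'_{i\to j})}{|wt(\gamma'_{i\to j})|}\neq-\frac{wt(\gamma_{i\to j})}{|wt(\gamma_{i\to j})|}.$$
   Context: An oriented graph $G$ is obtained from a finite simple undirected graph $G_u$ (its underlying graph) by giving each edge exactly one direction. It is unicyclic if $G_u$ is connected and has exactly one cycle. Each directed edge $(u,v)$ (from $u$ to $v$) has a non-zero complex weight $w_{uv}$; $\mathbb{R}^-$ denotes the negative real numbers. By convention, walks do not repeat vertices (hence do not repeat edges); that is, a walk from $i$ to $j$ is a path. Put $a_{ij}=w_{ij}$ if $(i,j)\in E(G)$, $a_{ij}=\overline{w_{ji}}$ if $(j,i)\in E(G)$, and $a_{ij}=0$ otherwise. The weight of a walk $\gamma=(i_1,\dots,i_k)$ is $wt(\gamma)=\prod_{s=1}^{k-1}a_{i_si_{s+1}}$ (so a trivial one-vertex walk has weight $1$). $wt(C)$ is the weight (given by the same product) of the closed traversal going once around $C$ in either direction; the two directions give complex conjugate values, so the condition on $wt(C)$ does not depend on the choice. -}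

module Defs where

open import Data.Fin.Base using (Fin)
open import Data.List.Base using (List; []; _∷_; length)
open import Data.List.Membership.Propositional using (_∈_)
open import Data.List.Relation.Unary.Unique.Propositional using (Unique)
open import Data.Nat.Coprimality using (1-coprimeTo)
open import Data.Nat.Base as ℕ using (ℕ; zero; suc)
import Data.Nat.Properties as ℕ
import Data.Integer.Base as ℤ
open import Data.Product.Base using (∃; ∃-syntax; _×_; _,_; proj₁; proj₂)
import Data.Rational.Unnormalised.Base as ℚᵘ
import Data.Rational.Unnormalised.Properties as ℚᵘ
open import Data.Rational.Base
open import Data.Rational.Properties
open import Data.Rational.Solver using (module +-*-Solver)
open import Data.Sum.Base using (_⊎_; inj₁; inj₂; [_,_]′)
open import Function.Bundles using (_⇔_)
open import Relation.Binary.Construct.Closure.ReflexiveTransitive using (Star; ε; _◅_)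
open import Relation.Binary.PropositionalEquality
open import Relation.Nullary using (¬_; Dec; yes; no; contradiction)

open +-*-Solver using (solve; _:+_; _:*_; :-_; _:-_; _:=_; con)

-- Ring identities, stated for variables so that the solver stays fast.
neg² : ∀ p → (- p) * (- p) ≡ p * p
neg² = solve 1 (λ p → (:- p) :* (:- p) := p :* p) refl

neg-sub : ∀ p q → - (p - q) ≡ q - p
neg-sub = solve 2 (λ p q → :- (p :- q) := q :- p) refl

sub-neg : ∀ p q → q - p ≡ (- p) - (- q)
sub-neg = solve 2 (λ p q → q :- p := (:- p) :- (:- q)) refl

sub-add : ∀ p q → p ≡ (p - q) + q
sub-add = solve 2 (λ p q → p := (p :- q) :+ q) refl

add-sub : ∀ p q → (p + q) - q ≡ p
add-sub = solve 2 (λ p q → (p :+ q) :- q := p) refl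

add-sub′ : ∀ p q → p + (q - p) ≡ q
add-sub′ = solve 2 (λ p q → p :+ (q :- p) := q) refl

bound-eq : ∀ p q r o → p + ((r - (p - q)) + (o - r)) ≡ q + o
bound-eq = solve 4 (λ p q r o → p :+ ((r :- (p :- q)) :+ (o :- r)) := q :+ o) refl

add-sub-add : ∀ p p′ q q′ → (p + q) - (p′ + q′) ≡ (p - p′) + (q - q′)
add-sub-add = solve 4 (λ p p′ q q′ → (p :+ q) :- (p′ :+ q′) := (p :- p′) :+ (q :- q′)) refl

mul-sub-mul : ∀ p p′ q q′ → p * q - p′ * q′ ≡ p * (q - q′) + q′ * (p - p′)
mul-sub-mul = solve 4 (λ p p′ q q′ →
  p :* q :- p′ :* q′ := p :* (q :- q′) :+ q′ :* (p :- p′)) refl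

recip-eq : ∀ p q r s → (p * q) * (r - s) ≡ (p * r) * q - (q * s) * p
recip-eq = solve 4 (λ p q r s → (p :* q) :* (r :- s) := (p :* r) :* q :- (q :* s) :* p) refl

swap-mul : ∀ p q r → p * (q * r) ≡ q * (p * r)
swap-mul = solve 3 (λ p q r → p :* (q :* r) := q :* (p :* r)) refl

suc² : ∀ y → (y + 1ℚ) + (y * y + y) ≡ (0ℚ + (y + 1ℚ)) * (0ℚ + (y + 1ℚ))
suc² = solve 1 (λ y → (y :+ con 1ℚ) :+ (y :* y :+ y) :=
                      (con 0ℚ :+ (y :+ con 1ℚ)) :* (con 0ℚ :+ (y :+ con 1ℚ))) refl

add² : ∀ u h → (u * u + h * h) + (u * h + u * h) ≡ (u + h) * (u + h)
add² = solve 2 (λ u h → (u :* u :+ h :* h) :+ (u :* h :+ u :* h) := (u :+ h) :* (u :+ h)) refl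

square-sub : ∀ s w → (s + w) * (s + w) - s * s ≡ (w + (s + s)) * w
square-sub = solve 2 (λ s w → (s :+ w) :* (s :+ w) :- s :* s := (w :+ (s :+ s)) :* w) refl

brahmagupta : ∀ a b c d → (a * a + b * b) * (c * c + d * d) ≡
  (a * c + - (b * d)) * (a * c + - (b * d)) + (a * d + b * c) * (a * d + b * c)
brahmagupta = solve 4 (λ a b c d → (a :* a :+ b :* b) :* (c :* c :+ d :* d) :=
  (a :* c :+ :- (b :* d)) :* (a :* c :+ :- (b :* d)) :+ (a :* d :+ b :* c) :* (a :* d :+ b :* c)) refl

0≤1 : 0ℚ ≤ 1ℚ
0≤1 = *≤* (ℤ.+≤+ ℕ.z≤n)

0≤½ : 0ℚ ≤ ½
0≤½ = *≤* (ℤ.+≤+ ℕ.z≤n)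

0<½ : 0ℚ < ½
0<½ = *<* (ℤ.+<+ (ℕ.s≤s ℕ.z≤n))

0<1 : 0ℚ < 1ℚ
0<1 = *<* (ℤ.+<+ (ℕ.s≤s ℕ.z≤n))

*-mono-≤₀ : ∀ {a b c d} → 0ℚ ≤ b → 0ℚ ≤ c → a ≤ b → c ≤ d → a * c ≤ b * d
*-mono-≤₀ {a} {b} {c} {d} 0≤b 0≤c a≤b c≤d = ≤-trans
  (*-monoʳ-≤-nonNeg c {{nonNegative 0≤c}} a≤b)
  (*-monoˡ-≤-nonNeg b {{nonNegative 0≤b}} c≤d)

0≤* : ∀ {a b} → 0ℚ ≤ a → 0ℚ ≤ b → 0ℚ ≤ a * b
0≤* {a} {b} 0≤a 0≤b = subst (_≤ a * b) (*-zeroˡ b) (*-monoʳ-≤-nonNeg b {{nonNegative 0≤b}} 0≤a)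

0<* : ∀ {a b} → 0ℚ < a → 0ℚ < b → 0ℚ < a * b
0<* {a} {b} 0<a 0<b = subst (_< a * b) (*-zeroˡ b) (*-monoˡ-<-pos b {{positive 0<b}} 0<a)

0≤+ : ∀ {a b} → 0ℚ ≤ a → 0ℚ ≤ b → 0ℚ ≤ a + b
0≤+ {a} {b} 0≤a 0≤b = subst (_≤ a + b) (+-identityˡ 0ℚ) (+-mono-≤ 0≤a 0≤b)

0≤- : ∀ {a b} → a ≤ b → 0ℚ ≤ b - a
0≤- {a} {b} a≤b = subst (_≤ b - a) (+-inverseʳ a) (+-monoˡ-≤ (- a) a≤b)

by-difference : ∀ {p q} d → 0ℚ ≤ d → p + d ≡ q → p ≤ q
by-difference {p} d 0≤d eq = subst₂ _≤_ (+-identityʳ p) eq (+-monoʳ-≤ p 0≤d)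

0≤² : ∀ a → 0ℚ ≤ a * a
0≤² a with ≤-total 0ℚ a
... | inj₁ 0≤a = 0≤* 0≤a 0≤a
... | inj₂ a≤0 = subst (0ℚ ≤_) (neg² a)
                   (0≤* (neg-antimono-≤ a≤0) (neg-antimono-≤ a≤0))

p≤∣p∣ : ∀ p → p ≤ ∣ p ∣
p≤∣p∣ p with ≤-total 0ℚ p
... | inj₁ 0≤p = ≤-reflexive (sym (0≤p⇒∣p∣≡p 0≤p))
... | inj₂ p≤0 = ≤-trans p≤0 (0≤∣p∣ p)

∣p∣≤ : ∀ {p e} → p ≤ e → - p ≤ e → ∣ p ∣ ≤ e
∣p∣≤ {p} p≤e -p≤e with ∣p∣≡p∨∣p∣≡-p p
... | inj₁ eq = subst (_≤ _) (sym eq) p≤e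
... | inj₂ eq = subst (_≤ _) (sym eq) -p≤e

∣p-q∣≡∣q-p∣ : ∀ p q → ∣ p - q ∣ ≡ ∣ q - p ∣
∣p-q∣≡∣q-p∣ p q = trans (sym (∣-p∣≡∣p∣ (p - q)))
  (cong ∣_∣ (neg-sub p q))

∣p∣-∣q∣≤∣p-q∣ : ∀ p q → ∣ p ∣ - ∣ q ∣ ≤ ∣ p - q ∣
∣p∣-∣q∣≤∣p-q∣ p q = begin
  ∣ p ∣ - ∣ q ∣
    ≡⟨ cong (λ r → ∣ r ∣ - ∣ q ∣) (sub-add p q) ⟩
  ∣ (p - q) + q ∣ - ∣ q ∣
    ≤⟨ +-monoˡ-≤ (- ∣ q ∣) (∣p+q∣≤∣p∣+∣q∣ (p - q) q) ⟩
  (∣ p - q ∣ + ∣ q ∣) - ∣ q ∣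
    ≡⟨ add-sub ∣ p - q ∣ ∣ q ∣ ⟩
  ∣ p - q ∣ ∎
  where open ≤-Reasoning

half+half : ∀ p → ½ * p + ½ * p ≡ p
half+half p = trans (sym (*-distribʳ-+ p ½ ½)) (*-identityˡ p)

⊔-split : ∀ N₁ N₂ {n} → N₁ ℕ.⊔ N₂ ℕ.≤ n → N₁ ℕ.≤ n × N₂ ℕ.≤ n
⊔-split N₁ N₂ le = ℕ.≤-trans (ℕ.m≤m⊔n N₁ N₂) le , ℕ.≤-trans (ℕ.m≤n⊔m N₁ N₂) le

-- Reciprocal, with the junk value 0 at 0.
recipℚ : ℚ → ℚ
recipℚ q with q ≟ 0ℚ
... | yes _   = 0ℚ
... | no  q≢0 = 1/_ q {{≢-nonZero q≢0}}

*-recipℚ : ∀ {q} → 0ℚ < q → q * recipℚ q ≡ 1ℚ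
*-recipℚ {q} 0<q with q ≟ 0ℚ
... | yes q≡0 = contradiction (sym q≡0) (<⇒≢ 0<q)
... | no  q≢0 = *-inverseʳ q {{≢-nonZero q≢0}}

divide : ∀ {b} e → 0ℚ < b → 0ℚ < e → ∃[ d ] (0ℚ < d × b * d ≡ e)
divide {b} e 0<b 0<e = recipℚ b * e , 0<* 0<r 0<e ,
  trans (sym (*-assoc b (recipℚ b) e)) (trans (cong (_* e) (*-recipℚ 0<b)) (*-identityˡ e))
  where
  0<r : 0ℚ < recipℚ b
  0<r with recipℚ b ≤? 0ℚ
  ... | no  r≰0 = ≰⇒> r≰0
  ... | yes r≤0 = contradiction
    (subst₂ _≤_ (*-recipℚ 0<b) (*-zeroʳ b) (*-monoˡ-≤-nonNeg b {{nonNegative (<⇒≤ 0<b)}} r≤0))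
    (<⇒≱ 0<1)
    where
    <⇒≱ : ∀ {p q} → p < q → ¬ (q ≤ p)
    <⇒≱ p<q q≤p = <-irrefl refl (<-≤-trans p<q q≤p)

-- Real numbers are Cauchy sequences of rationals, with _≈ʳ_ (difference a null
-- sequence) as their equality.

IsCauchy : (ℕ → ℚ) → Set
IsCauchy x = ∀ e → 0ℚ < e → ∃[ N ] (∀ m n → N ℕ.≤ m → N ℕ.≤ n → ∣ x m - x n ∣ ≤ e)

-- Without eta, comparing reals never unfolds their convergence proofs.
record ℝ : Set where
  no-eta-equality
  constructor mkℝ
  field
    seq    : ℕ → ℚ
    cauchy : IsCauchy seq

open ℝ public

infix 4 _≈ʳ_ _<ʳ_

record _≈ʳ_ (x y : ℝ) : Set where
  constructor mk≈ʳ
  field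
    null : ∀ e → 0ℚ < e → ∃[ N ] (∀ n → N ℕ.≤ n → ∣ seq x n - seq y n ∣ ≤ e)

record _<ʳ_ (x y : ℝ) : Set where
  constructor mk<ʳ
  field
    gap : ∃[ e ] (0ℚ < e × ∃[ N ] (∀ n → N ℕ.≤ n → seq x n + e ≤ seq y n))

-- It suffices to bound x m - x n from above, by symmetry in m and n.
one-sided : ∀ (x : ℕ → ℚ) →
  (∀ e → 0ℚ < e → ∃[ N ] (∀ m n → N ℕ.≤ m → N ℕ.≤ n → x m - x n ≤ e)) → IsCauchy x
one-sided x h e 0<e with h e 0<e
... | N , b = N , λ m n N≤m N≤n → ∣p∣≤ (b m n N≤m N≤n)
  (subst (_≤ e) (sym (neg-sub (x m) (x n))) (b n m N≤n N≤m))

bounded : ∀ x → IsCauchy x → ∃[ B ] (0ℚ < B × ∃[ N ] (∀ n → N ℕ.≤ n → ∣ x n ∣ ≤ B))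
bounded x cx with cx 1ℚ 0<1
... | N , b = ∣ x N ∣ + 1ℚ
  , subst (_< ∣ x N ∣ + 1ℚ) (+-identityˡ 0ℚ) (+-mono-≤-< (0≤∣p∣ (x N)) 0<1)
  , N , λ n N≤n → by-difference
      ((∣ x n - x N ∣ - (∣ x n ∣ - ∣ x N ∣)) + (1ℚ - ∣ x n - x N ∣))
      (0≤+ (0≤- (∣p∣-∣q∣≤∣p-q∣ (x n) (x N))) (0≤- (b n N N≤n ℕ.≤-refl)))
      (bound-eq (∣ x n ∣) (∣ x N ∣) (∣ x n - x N ∣) 1ℚ)

+-close : ∀ {e} p p′ q q′ → ∣ p - p′ ∣ ≤ ½ * e → ∣ q - q′ ∣ ≤ ½ * e →
  ∣ (p + q) - (p′ + q′) ∣ ≤ e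
+-close {e} p p′ q q′ near₁ near₂ = begin
  ∣ (p + q) - (p′ + q′) ∣      ≡⟨ cong ∣_∣ (add-sub-add p p′ q q′) ⟩
  ∣ (p - p′) + (q - q′) ∣      ≤⟨ ∣p+q∣≤∣p∣+∣q∣ (p - p′) (q - q′) ⟩
  ∣ p - p′ ∣ + ∣ q - q′ ∣      ≤⟨ +-mono-≤ near₁ near₂ ⟩
  ½ * e + ½ * e                ≡⟨ half+half e ⟩
  e                            ∎
  where open ≤-Reasoning

*-close : ∀ {e B C d d′} p p′ q q′ → 0ℚ ≤ B → 0ℚ ≤ C → B * d ≡ ½ * e → C * d′ ≡ ½ * e →
  ∣ p ∣ ≤ B → ∣ q′ ∣ ≤ C → ∣ p - p′ ∣ ≤ d′ → ∣ q - q′ ∣ ≤ d → ∣ p * q - p′ * q′ ∣ ≤ e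
*-close {e} {B} {C} {d} {d′} p p′ q q′ 0≤B 0≤C Bd≡ Cd′≡ p≤B q′≤C near₁ near₂ = begin
  ∣ p * q - p′ * q′ ∣
    ≡⟨ cong ∣_∣ (mul-sub-mul p p′ q q′) ⟩
  ∣ p * (q - q′) + q′ * (p - p′) ∣
    ≤⟨ ∣p+q∣≤∣p∣+∣q∣ (p * (q - q′)) (q′ * (p - p′)) ⟩
  ∣ p * (q - q′) ∣ + ∣ q′ * (p - p′) ∣
    ≡⟨ cong₂ _+_ (∣p*q∣≡∣p∣*∣q∣ p (q - q′)) (∣p*q∣≡∣p∣*∣q∣ q′ (p - p′)) ⟩
  ∣ p ∣ * ∣ q - q′ ∣ + ∣ q′ ∣ * ∣ p - p′ ∣
    ≤⟨ +-mono-≤ (*-mono-≤₀ 0≤B (0≤∣p∣ (q - q′)) p≤B near₂)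
                (*-mono-≤₀ 0≤C (0≤∣p∣ (p - p′)) q′≤C near₁) ⟩
  B * d + C * d′
    ≡⟨ cong₂ _+_ Bd≡ Cd′≡ ⟩
  ½ * e + ½ * e
    ≡⟨ half+half e ⟩
  e ∎
  where open ≤-Reasoning

recip-close : ∀ {e δ} p q → 0ℚ < δ → δ ≤ p → δ ≤ q → ∣ q - p ∣ ≤ (δ * δ) * e →
  ∣ recipℚ p - recipℚ q ∣ ≤ e
recip-close {e} {δ} p q 0<δ δ≤p δ≤q near = *-cancelˡ-≤-pos (δ * δ) {{positive (0<* 0<δ 0<δ)}} (begin
  (δ * δ) * ∣ p⁻ - q⁻ ∣
    ≤⟨ *-monoʳ-≤-nonNeg ∣ p⁻ - q⁻ ∣ {{∣-∣-nonNeg (p⁻ - q⁻)}}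
         (*-mono-≤₀ (<⇒≤ 0<p) (<⇒≤ 0<δ) δ≤p δ≤q) ⟩
  (p * q) * ∣ p⁻ - q⁻ ∣
    ≡⟨ cong (_* ∣ p⁻ - q⁻ ∣) (sym (0≤p⇒∣p∣≡p (0≤* (<⇒≤ 0<p) (<⇒≤ 0<q)))) ⟩
  ∣ p * q ∣ * ∣ p⁻ - q⁻ ∣
    ≡⟨ sym (∣p*q∣≡∣p∣*∣q∣ (p * q) (p⁻ - q⁻)) ⟩
  ∣ (p * q) * (p⁻ - q⁻) ∣
    ≡⟨ cong ∣_∣ (recip-eq p q p⁻ q⁻) ⟩
  ∣ (p * p⁻) * q - (q * q⁻) * p ∣
    ≡⟨ cong₂ (λ u v → ∣ u * q - v * p ∣) (*-recipℚ 0<p) (*-recipℚ 0<q) ⟩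
  ∣ 1ℚ * q - 1ℚ * p ∣
    ≡⟨ cong₂ (λ u v → ∣ u - v ∣) (*-identityˡ q) (*-identityˡ p) ⟩
  ∣ q - p ∣
    ≤⟨ near ⟩
  (δ * δ) * e ∎)
  where
  open ≤-Reasoning
  p⁻ = recipℚ p
  q⁻ = recipℚ q
  0<p = <-≤-trans 0<δ δ≤p
  0<q = <-≤-trans 0<δ δ≤q

fromℚ : ℚ → ℝ
fromℚ q = mkℝ (λ _ → q) λ e 0<e → 0 , λ _ _ _ _ →
  subst (λ r → ∣ r ∣ ≤ e) (sym (+-inverseʳ q)) (<⇒≤ 0<e)

0ʳ 1ʳ : ℝ
0ʳ = fromℚ 0ℚ
1ʳ = fromℚ 1ℚ

infix  8 -ʳ_
infixl 7 _*ʳ_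
infixl 6 _+ʳ_ _-ʳ_

-ʳ_ : ℝ → ℝ
seq    (-ʳ x) n = - seq x n
cauchy (-ʳ x) e 0<e with cauchy x e 0<e
... | N , b = N , λ m n N≤m N≤n → subst (_≤ e)
  (trans (∣p-q∣≡∣q-p∣ (seq x m) (seq x n))
    (cong ∣_∣ (sub-neg (seq x m) (seq x n))))
  (b m n N≤m N≤n)

_+ʳ_ : ℝ → ℝ → ℝ
seq    (x +ʳ y) n = seq x n + seq y n
cauchy (x +ʳ y) e 0<e with cauchy x (½ * e) (0<* 0<½ 0<e) | cauchy y (½ * e) (0<* 0<½ 0<e)
... | N₁ , b₁ | N₂ , b₂ = N₁ ℕ.⊔ N₂ , λ m n N≤m N≤n →
  let M₁ , M₂ = ⊔-split N₁ N₂ N≤m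
      L₁ , L₂ = ⊔-split N₁ N₂ N≤n
  in +-close {e = e} (seq x m) (seq x n) (seq y m) (seq y n) (b₁ m n M₁ L₁) (b₂ m n M₂ L₂)

_-ʳ_ : ℝ → ℝ → ℝ
x -ʳ y = x +ʳ (-ʳ y)

_*ʳ_ : ℝ → ℝ → ℝ
seq    (x *ʳ y) n = seq x n * seq y n
cauchy (x *ʳ y) e 0<e =
  let B , 0<B , N₁ , bx = bounded (seq x) (cauchy x)
      C , 0<C , N₂ , by = bounded (seq y) (cauchy y)
      d  , 0<d  , Bd≡   = divide (½ * e) 0<B (0<* 0<½ 0<e)
      d′ , 0<d′ , Cd′≡  = divide (½ * e) 0<C (0<* 0<½ 0<e)
      N₃ , cy = cauchy y d 0<d
      N₄ , cx = cauchy x d′ 0<d′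
  in (N₁ ℕ.⊔ N₂) ℕ.⊔ (N₃ ℕ.⊔ N₄) , λ m n N≤m N≤n →
  let M₁₂ , M₃₄ = ⊔-split (N₁ ℕ.⊔ N₂) (N₃ ℕ.⊔ N₄) N≤m
      L₁₂ , L₃₄ = ⊔-split (N₁ ℕ.⊔ N₂) (N₃ ℕ.⊔ N₄) N≤n
      M₁ , _  = ⊔-split N₁ N₂ M₁₂
      M₃ , M₄ = ⊔-split N₃ N₄ M₃₄
      _  , L₂ = ⊔-split N₁ N₂ L₁₂
      L₃ , L₄ = ⊔-split N₃ N₄ L₃₄
  in *-close (seq x m) (seq x n) (seq y m) (seq y n) (<⇒≤ 0<B) (<⇒≤ 0<C) Bd≡ Cd′≡
       (bx m M₁) (by n L₂) (cx m n M₄ L₄) (cy m n M₃ L₃)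

-- The terms are independent of the positivity proof, which only ensures convergence.
recip : (x : ℝ) → 0ʳ <ʳ x → ℝ
seq    (recip x _) n = recipℚ (seq x n)
cauchy (recip x (mk<ʳ (δ , 0<δ , N₀ , lb))) e 0<e with cauchy x ((δ * δ) * e) (0<* (0<* 0<δ 0<δ) 0<e)
... | N₁ , b = N₀ ℕ.⊔ N₁ , λ m n N≤m N≤n →
  let M₀ , M₁ = ⊔-split N₀ N₁ N≤m
      L₀ , L₁ = ⊔-split N₀ N₁ N≤n
  in recip-close (seq x m) (seq x n) 0<δ
       (subst (_≤ seq x m) (+-identityˡ δ) (lb m M₀))
       (subst (_≤ seq x n) (+-identityˡ δ) (lb n L₀))
       (b n m L₁ M₁)

-- For y ≥ 0, √y lies in [ lower y n , lower y n + width y n ), an interval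
-- obtained from [ 0 , y + 1 ) by n bisections.

width : ℚ → ℕ → ℚ
width y zero    = y + 1ℚ
width y (suc n) = ½ * width y n

bisect : (y l w : ℚ) → ℚ
bisect y l w with (l + w) * (l + w) ≤? y
... | yes _ = l + w
... | no  _ = l

lower : ℚ → ℕ → ℚ
lower y zero    = 0ℚ
lower y (suc n) = bisect y (lower y n) (width y (suc n))

0≤bisect : ∀ y {l w} → 0ℚ ≤ l → 0ℚ ≤ w → 0ℚ ≤ bisect y l w
0≤bisect y {l} {w} 0≤l 0≤w with (l + w) * (l + w) ≤? y
... | yes _ = 0≤+ 0≤l 0≤w
... | no  _ = 0≤l

bisect²≤ : ∀ y l w → l * l ≤ y → bisect y l w * bisect y l w ≤ y
bisect²≤ y l w l²≤y with (l + w) * (l + w) ≤? y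
... | yes le = le
... | no  _  = l²≤y

<bisect² : ∀ y l w → y < (l + (w + w)) * (l + (w + w)) →
  y < (bisect y l w + w) * (bisect y l w + w)
<bisect² y l w y<u² with (l + w) * (l + w) ≤? y
... | yes _  = subst (λ u → y < u * u) (sym (+-assoc l w w)) y<u²
... | no  gt = ≰⇒> gt

0≤width : ∀ {y} → 0ℚ ≤ y → ∀ n → 0ℚ ≤ width y n
0≤width 0≤y zero    = 0≤+ 0≤y 0≤1
0≤width 0≤y (suc n) = 0≤* 0≤½ (0≤width 0≤y n)

0≤lower : ∀ {y} → 0ℚ ≤ y → ∀ n → 0ℚ ≤ lower y n
0≤lower     0≤y zero    = ≤-refl
0≤lower {y} 0≤y (suc n) = 0≤bisect y (0≤lower 0≤y n) (0≤width 0≤y (suc n))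

lower²≤ : ∀ {y} → 0ℚ ≤ y → ∀ n → lower y n * lower y n ≤ y
lower²≤     0≤y zero    = 0≤y
lower²≤ {y} 0≤y (suc n) = bisect²≤ y (lower y n) (width y (suc n)) (lower²≤ 0≤y n)

y<[y+1]² : ∀ {y} → 0ℚ ≤ y → y < (0ℚ + (y + 1ℚ)) * (0ℚ + (y + 1ℚ))
y<[y+1]² {y} 0≤y = <-≤-trans
  (subst (_< y + 1ℚ) (+-identityʳ y) (+-monoʳ-< y 0<1))
  (by-difference (y * y + y) (0≤+ (0≤² y) 0≤y) (suc² y))

<upper² : ∀ {y} → 0ℚ ≤ y → ∀ n → y < (lower y n + width y n) * (lower y n + width y n)
<upper²     0≤y zero    = y<[y+1]² 0≤y
<upper² {y} 0≤y (suc n) = <bisect² y (lower y n) (½ * width y n)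
  (subst (λ v → y < (lower y n + v) * (lower y n + v)) (sym (half+half (width y n))) (<upper² 0≤y n))

halfPower : ℕ → ℚ
halfPower zero    = 1ℚ
halfPower (suc n) = ½ * halfPower n

width-halfPower : ∀ y n → width y n ≡ (y + 1ℚ) * halfPower n
width-halfPower y zero    = sym (*-identityʳ (y + 1ℚ))
width-halfPower y (suc n) = trans (cong (½ *_) (width-halfPower y n))
  (swap-mul ½ (y + 1ℚ) (halfPower n))

1/suc : ℕ → ℚ
1/suc n = mkℚ (ℤ.+ 1) n (1-coprimeTo (suc n))

halfPower≤ : ∀ n → halfPower n ≤ 1/suc n
halfPower≤ zero    = ≤-refl
halfPower≤ (suc n) = ≤-trans (*-monoˡ-≤-nonNeg ½ (halfPower≤ n))
  (toℚᵘ-cancel-≤ (ℚᵘ.≤-trans (ℚᵘ.≤-reflexive (toℚᵘ-homo-* ½ (1/suc n)))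
    (ℚᵘ.*≤* (ℤ.+≤+ (begin
      1 ℕ.* suc (suc n)     ≡⟨ ℕ.*-identityˡ (suc (suc n)) ⟩
      suc (suc n)           ≤⟨ ℕ.s≤s (ℕ.m≤n+m (suc n) n) ⟩
      suc (n ℕ.+ suc n)     ≡⟨ cong (λ k → suc (n ℕ.+ k)) (sym (ℕ.+-identityʳ (suc n))) ⟩
      2 ℕ.* suc n           ≡⟨ sym (ℕ.*-identityˡ (2 ℕ.* suc n)) ⟩
      1 ℕ.* (2 ℕ.* suc n)   ∎)))))
  where open ℕ.≤-Reasoning

1/suc≤ : ∀ e → 0ℚ < e → ∃[ N ] (∀ n → N ℕ.≤ n → 1/suc n ≤ e)
1/suc≤ (mkℚ (ℤ.+ zero) q _) (*<* (ℤ.+<+ ()))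
1/suc≤ (mkℚ (ℤ.-[1+ p ]) q _) (*<* ())
1/suc≤ (mkℚ (ℤ.+ suc p) q _) _ = q , λ n q≤n →
  *≤* (ℤ.+≤+ (ℕ.*-mono-≤ {1} {suc p} {suc q} {suc n} (ℕ.s≤s ℕ.z≤n) (ℕ.s≤s q≤n)))

halfPower→0 : ∀ e → 0ℚ < e → ∃[ N ] (∀ n → N ℕ.≤ n → halfPower n ≤ e)
halfPower→0 e 0<e with 1/suc≤ e 0<e
... | N , b = N , λ n N≤n → ≤-trans (halfPower≤ n) (b n N≤n)

0≤halfPower : ∀ n → 0ℚ ≤ halfPower n
0≤halfPower zero    = 0≤1
0≤halfPower (suc n) = 0≤* 0≤½ (0≤halfPower n)

width→0 : ∀ x → IsCauchy x → ∀ e → 0ℚ < e → ∃[ N ] (∀ n → N ℕ.≤ n → width ∣ x n ∣ n ≤ e)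
width→0 x cx e 0<e =
  let B , 0<B , N₁ , b₁ = bounded x cx
      0≤B+1 = 0≤+ (<⇒≤ 0<B) 0≤1
      d , 0<d , B+1*d≡e = divide {B + 1ℚ} e (<-≤-trans 0<B (by-difference 1ℚ 0≤1 refl)) 0<e
      N₂ , b₂ = halfPower→0 d 0<d
  in N₁ ℕ.⊔ N₂ , λ n N≤n →
    let L₁ , L₂ = ⊔-split N₁ N₂ N≤n in
    subst₂ _≤_ (sym (width-halfPower ∣ x n ∣ n)) B+1*d≡e
      (*-mono-≤₀ 0≤B+1 (0≤halfPower n) (+-monoˡ-≤ 1ℚ (b₁ n L₁)) (b₂ n L₂))

-- √|x|, total in x; used only at non-negative x.
√∣_∣ : ℝ → ℝ
seq    √∣ x ∣ n = lower ∣ seq x n ∣ n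
cauchy √∣ x ∣ = one-sided (λ n → lower ∣ seq x n ∣ n) λ e 0<e →
  let h    = ½ * e
      0<h  = 0<* 0<½ 0<e
      N₁ , near  = cauchy x (h * h) (0<* 0<h 0<h)
      N₂ , small = width→0 (seq x) (cauchy x) h 0<h
  in N₁ ℕ.⊔ N₂ , λ m n N≤m N≤n →
    let L₁ , L₂ = ⊔-split N₁ N₂ N≤n
    in close {∣ seq x m ∣} {∣ seq x n ∣} {e} (0≤∣p∣ (seq x m)) (0≤∣p∣ (seq x n)) m n 0<e (small n L₂)
         (≤-trans (∣p∣-∣q∣≤∣p-q∣ (seq x m) (seq x n)) (near m n (proj₁ (⊔-split N₁ N₂ N≤m)) L₁))
  where
  close : ∀ {y y′ e} → 0ℚ ≤ y → 0ℚ ≤ y′ → ∀ m n → 0ℚ < e → width y′ n ≤ ½ * e →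
    y - y′ ≤ (½ * e) * (½ * e) → lower y m - lower y′ n ≤ e
  close {y} {y′} {e} 0≤y 0≤y′ m n 0<e w≤h near with (lower y m - lower y′ n) ≤? e
  ... | yes le = le
  ... | no  gt = contradiction refl (<⇒≢ y<y)
    where
    open ≤-Reasoning
    s = lower y m
    t = lower y′ n
    w = width y′ n
    h = ½ * e
    0≤h : 0ℚ ≤ h
    0≤h = <⇒≤ (0<* 0<½ 0<e)
    0≤u : 0ℚ ≤ t + w
    0≤u = 0≤+ (0≤lower 0≤y′ n) (0≤width 0≤y′ n)
    u+h≤s : (t + w) + h ≤ s
    u+h≤s = begin
      (t + w) + h   ≤⟨ +-monoˡ-≤ h (+-monoʳ-≤ t w≤h) ⟩
      (t + h) + h   ≡⟨ +-assoc t h h ⟩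
      t + (h + h)   ≡⟨ cong (t +_) (half+half e) ⟩
      t + e         ≤⟨ +-monoʳ-≤ t (<⇒≤ (≰⇒> gt)) ⟩
      t + (s - t)   ≡⟨ add-sub′ t s ⟩
      s             ∎
    y<y : y < y
    y<y = begin-strict
      y                            ≡⟨ sym (add-sub′ y′ y) ⟩
      y′ + (y - y′)                ≤⟨ +-monoʳ-≤ y′ near ⟩
      y′ + h * h                   <⟨ +-monoˡ-< (h * h) (<upper² 0≤y′ n) ⟩
      (t + w) * (t + w) + h * h    ≤⟨ by-difference ((t + w) * h + (t + w) * h)
                                        (0≤+ (0≤* 0≤u 0≤h) (0≤* 0≤u 0≤h))
                                        (add² (t + w) h) ⟩
      ((t + w) + h) * ((t + w) + h) ≤⟨ *-mono-≤₀ (0≤lower 0≤y m) (0≤+ 0≤u 0≤h) u+h≤s u+h≤s ⟩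
      s * s                        ≤⟨ lower²≤ 0≤y m ⟩
      y                            ∎

lower≤width₀ : ∀ {y} → 0ℚ ≤ y → ∀ n → lower y n ≤ y + 1ℚ
lower≤width₀ {y} 0≤y n with lower y n ≤? y + 1ℚ
... | yes le = le
... | no  gt = contradiction refl (<⇒≢ y<y)
  where
  open ≤-Reasoning
  u = y + 1ℚ
  0≤u : 0ℚ ≤ u
  0≤u = 0≤+ 0≤y 0≤1
  y<y : y < y
  y<y = begin-strict
    y                       <⟨ y<[y+1]² 0≤y ⟩
    (0ℚ + u) * (0ℚ + u)     ≡⟨ cong (λ v → v * v) (+-identityˡ u) ⟩
    u * u                   ≤⟨ *-mono-≤₀ (0≤lower 0≤y n) 0≤u (<⇒≤ (≰⇒> gt)) (<⇒≤ (≰⇒> gt)) ⟩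
    lower y n * lower y n   ≤⟨ lower²≤ 0≤y n ⟩
    y                       ∎

width≤width₀ : ∀ {y} → 0ℚ ≤ y → ∀ n → width y n ≤ y + 1ℚ
width≤width₀     0≤y zero    = ≤-refl
width≤width₀ {y} 0≤y (suc n) = ≤-trans
  (by-difference (½ * width y n) (0≤width 0≤y (suc n)) (half+half (width y n)))
  (width≤width₀ 0≤y n)

lower²-close : ∀ {y B d} → 0ℚ ≤ y → y ≤ B → ∀ n → width y n ≤ d →
  ∣ lower y n * lower y n - y ∣ ≤ ((B + 1ℚ) + ((B + 1ℚ) + (B + 1ℚ))) * d
lower²-close {y} {B} {d} 0≤y y≤B n w≤d = ∣p∣≤ below above
  where
  open ≤-Reasoning
  s = lower y n
  w = width y n
  K = B + 1ℚ
  0≤s = 0≤lower 0≤y n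
  0≤w = 0≤width 0≤y n
  y+1≤K : y + 1ℚ ≤ K
  y+1≤K = +-monoˡ-≤ 1ℚ y≤B
  0≤K : 0ℚ ≤ K
  0≤K = ≤-trans (0≤+ 0≤y 0≤1) y+1≤K
  0≤3K : 0ℚ ≤ K + (K + K)
  0≤3K = 0≤+ 0≤K (0≤+ 0≤K 0≤K)
  below : s * s - y ≤ (K + (K + K)) * d
  below = begin
    s * s - y            ≤⟨ +-monoˡ-≤ (- y) (lower²≤ 0≤y n) ⟩
    y - y                ≡⟨ +-inverseʳ y ⟩
    0ℚ                   ≤⟨ 0≤* 0≤3K (≤-trans 0≤w w≤d) ⟩
    (K + (K + K)) * d    ∎
  above : - (s * s - y) ≤ (K + (K + K)) * d
  above = begin
    - (s * s - y)                ≡⟨ neg-sub (s * s) y ⟩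
    y - s * s                    ≤⟨ +-monoˡ-≤ (- (s * s)) (<⇒≤ (<upper² 0≤y n)) ⟩
    (s + w) * (s + w) - s * s    ≡⟨ square-sub s w ⟩
    (w + (s + s)) * w            ≤⟨ *-mono-≤₀ 0≤3K 0≤w
                                      (+-mono-≤ (≤-trans (width≤width₀ 0≤y n) y+1≤K)
                                        (+-mono-≤ s≤K s≤K)) w≤d ⟩
    (K + (K + K)) * d            ∎
    where
    s≤K : s ≤ K
    s≤K = ≤-trans (lower≤width₀ 0≤y n) y+1≤K

infix 4 _≈ᶜ_
infix  8 -ᶜ_
infixl 7 _*ᶜ_ _/ᶜ_

record ℂ : Set where
  constructor _+i_
  field
    re im : ℝ

open ℂ public

record _≈ᶜ_ (z w : ℂ) : Set where
  constructor mk≈ᶜ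
  field
    re≈ : re z ≈ʳ re w
    im≈ : im z ≈ʳ im w

0ᶜ 1ᶜ : ℂ
0ᶜ = 0ʳ +i 0ʳ
1ᶜ = 1ʳ +i 0ʳ

-ᶜ_ conj : ℂ → ℂ
-ᶜ z   = (-ʳ re z) +i (-ʳ im z)
conj z = re z +i (-ʳ im z)

_*ᶜ_ : ℂ → ℂ → ℂ
z *ᶜ w = (re z *ʳ re w -ʳ im z *ʳ im w) +i (re z *ʳ im w +ʳ im z *ʳ re w)

normSq : ℂ → ℝ
normSq z = re z *ʳ re z +ʳ im z *ʳ im z

modulus : ℂ → ℝ
modulus z = √∣ normSq z ∣

nsq : ℂ → ℕ → ℚ
nsq z n = seq (normSq z) n

0≤nsq : ∀ z n → 0ℚ ≤ nsq z n
0≤nsq z n = 0≤+ (0≤² (seq (re z) n)) (0≤² (seq (im z) n))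

modulus² : ∀ z → modulus z *ʳ modulus z ≈ʳ normSq z
modulus² z = mk≈ʳ λ e 0<e →
  let B , 0<B , N₁ , b₁ = bounded (nsq z) (cauchy (normSq z))
      C = (B + 1ℚ) + ((B + 1ℚ) + (B + 1ℚ))
      0≤B+1 = 0≤+ (<⇒≤ 0<B) 0≤1
      0<B+1 = <-≤-trans 0<B (by-difference 1ℚ 0≤1 refl)
      0<C = <-≤-trans 0<B+1 (by-difference ((B + 1ℚ) + (B + 1ℚ)) (0≤+ 0≤B+1 0≤B+1) refl)
      d , 0<d , Cd≡e = divide {C} e 0<C 0<e
      N₂ , small = width→0 (nsq z) (cauchy (normSq z)) d 0<d
  in N₁ ℕ.⊔ N₂ , λ n N≤n →
    let L₁ , L₂ = ⊔-split N₁ N₂ N≤n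
    in subst₂ (λ y f → ∣ seq (modulus z) n * seq (modulus z) n - y ∣ ≤ f)
         (0≤p⇒∣p∣≡p (0≤nsq z n)) Cd≡e
         (lower²-close {B = B} (0≤∣p∣ (nsq z n)) (b₁ n L₁) n (small n L₂))

-- Non-zero in the constructive sense |z| > 0, which is what division by |z| needs;
-- classically this is the same as z ≉ 0.
Nonzero : ℂ → Set
Nonzero z = 0ʳ <ʳ modulus z

_/ᶜ_ : ℂ → ∃ (0ʳ <ʳ_) → ℂ
z /ᶜ (r , 0<r) = (re z *ʳ recip r 0<r) +i (im z *ʳ recip r 0<r)

-- z / |z|
direction : (z : ℂ) → Nonzero z → ℂ
direction z z≠0 = z /ᶜ (modulus z , z≠0)

NegativeReal : ℂ → Set
NegativeReal z = re z <ʳ 0ʳ × im z ≈ʳ 0ʳ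

-- The squared moduli of the approximations are eventually bounded away from 0.
Away : ℂ → Set
Away z = ∃[ e ] (0ℚ < e × ∃[ N ] (∀ n → N ℕ.≤ n → e ≤ nsq z n))

nonzero⇒away : ∀ z → Nonzero z → Away z
nonzero⇒away z (mk<ʳ (e , 0<e , N , b)) = e * e , 0<* 0<e 0<e , N , λ n N≤n →
  let e≤s = subst (_≤ seq (modulus z) n) (+-identityˡ e) (b n N≤n)
  in subst (e * e ≤_) (0≤p⇒∣p∣≡p (0≤nsq z n)) (≤-trans
       (*-mono-≤₀ (0≤lower (0≤∣p∣ (nsq z n)) n) (<⇒≤ 0<e) e≤s e≤s)
       (lower²≤ (0≤∣p∣ (nsq z n)) n))

small-square : ∀ e → 0ℚ < e → ∃[ d ] (0ℚ < d × (d + d) * (d + d) ≤ e)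
small-square e 0<e with ≤-total e 1ℚ
... | inj₁ e≤1 = ½ * e , 0<* 0<½ 0<e
  , subst (λ u → u * u ≤ e) (sym (half+half e))
      (subst (e * e ≤_) (*-identityʳ e) (*-monoˡ-≤-nonNeg e {{nonNegative (<⇒≤ 0<e)}} e≤1))
... | inj₂ 1≤e = ½ , 0<½ , 1≤e

d≤lower : ∀ {y d e} → 0ℚ ≤ y → (d + d) * (d + d) ≤ e → e ≤ y → ∀ n → width y n ≤ d → d ≤ lower y n
d≤lower {y} {d} {e} 0≤y 4d²≤e e≤y n w≤d with d ≤? lower y n
... | yes le = le
... | no  gt = contradiction refl (<⇒≢ y<y)
  where
  open ≤-Reasoning
  u = lower y n + width y n
  0≤u : 0ℚ ≤ u
  0≤u = 0≤+ (0≤lower 0≤y n) (0≤width 0≤y n)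
  u≤2d : u ≤ d + d
  u≤2d = +-mono-≤ (<⇒≤ (≰⇒> gt)) w≤d
  y<y : y < y
  y<y = begin-strict
    y                   <⟨ <upper² 0≤y n ⟩
    u * u               ≤⟨ *-mono-≤₀ (≤-trans 0≤u u≤2d) 0≤u u≤2d u≤2d ⟩
    (d + d) * (d + d)   ≤⟨ 4d²≤e ⟩
    e                   ≤⟨ e≤y ⟩
    y                   ∎

away⇒nonzero : ∀ z → Away z → Nonzero z
away⇒nonzero z (e , 0<e , N₁ , b) =
  let d , 0<d , 4d²≤e = small-square e 0<e
      N₂ , small = width→0 (nsq z) (cauchy (normSq z)) d 0<d
  in mk<ʳ (d , 0<d , N₁ ℕ.⊔ N₂ , λ n N≤n →
    let L₁ , L₂ = ⊔-split N₁ N₂ N≤n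
    in subst (_≤ seq (modulus z) n) (sym (+-identityˡ d))
         (d≤lower (0≤∣p∣ (nsq z n)) 4d²≤e (≤-trans (b n L₁) (p≤∣p∣ (nsq z n))) n (small n L₂)))

1ᶜ-nonzero : Nonzero 1ᶜ
1ᶜ-nonzero = away⇒nonzero 1ᶜ (1ℚ , 0<1 , 0 , λ _ _ → ≤-refl)

conj-away : ∀ z → Away z → Away (conj z)
conj-away z (e , 0<e , N , b) = e , 0<e , N , λ n N≤n →
  subst (λ q → e ≤ seq (re z) n * seq (re z) n + q) (sym (neg² (seq (im z) n))) (b n N≤n)

conj-nonzero : ∀ z → Nonzero z → Nonzero (conj z)
conj-nonzero z z≠0 = away⇒nonzero (conj z) (conj-away z (nonzero⇒away z z≠0))

*ᶜ-away : ∀ z w → Away z → Away w → Away (z *ᶜ w)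
*ᶜ-away z w (d , 0<d , N₁ , b₁) (e , 0<e , N₂ , b₂) =
  d * e , 0<* 0<d 0<e , N₁ ℕ.⊔ N₂ , λ n N≤n →
    let L₁ , L₂ = ⊔-split N₁ N₂ N≤n
    in subst (d * e ≤_)
         (brahmagupta (seq (re z) n) (seq (im z) n) (seq (re w) n) (seq (im w) n))
         (*-mono-≤₀ (0≤nsq z n) (<⇒≤ 0<e) (b₁ n L₁) (b₂ n L₂))

*ᶜ-nonzero : ∀ z w → Nonzero z → Nonzero w → Nonzero (z *ᶜ w)
*ᶜ-nonzero z w z≠0 w≠0 =
  away⇒nonzero (z *ᶜ w) (*ᶜ-away z w (nonzero⇒away z z≠0) (nonzero⇒away w w≠0))

record SimpleGraph (n : ℕ) : Set₁ where
  field
    Edge        : Fin n → Fin n → Set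
    edge-sym    : ∀ {u v} → Edge u v → Edge v u
    edge-irrefl : ∀ {u} → ¬ Edge u u

module _ {n : ℕ} (H : SimpleGraph n) where
  open SimpleGraph H

  vertices : ∀ {i j} → Star Edge i j → List (Fin n)
  vertices {i} ε        = i ∷ []
  vertices {i} (_ ◅ es) = i ∷ vertices es

  edges : ∀ {i j} → Star Edge i j → List (Fin n × Fin n)
  edges ε                = []
  edges (_◅_ {i} {j} _ es) = (i , j) ∷ edges es

  -- Walks are paths: no vertex is repeated.
  record Walk (i j : Fin n) : Set where
    field
      steps    : Star Edge i j
      distinct : Unique (vertices steps)

  -- A cycle, traversed once from base along a walk to end and back along the
  -- edge from end to base.  The walk has at least three vertices.
  record Cycle : Set where
    field
      base end : Fin n
      walk     : Walk base end
      closing  : Edge end base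
      long     : 3 ℕ.≤ length (vertices (Walk.steps walk))

  OnCycle : Cycle → Fin n → Fin n → Set
  OnCycle C u v = (u , v) ∈ traversal ⊎ (v , u) ∈ traversal
    where
    open Cycle C
    traversal = (end , base) ∷ edges (Walk.steps walk)

  -- Cycles are compared as subgraphs, so traversals of one cycle that differ in
  -- starting point or direction count as the same.
  SameCycle : Cycle → Cycle → Set
  SameCycle C D = ∀ u v → OnCycle C u v ⇔ OnCycle D u v

  record Unicyclic : Set where
    field
      connected : ∀ i j → Star Edge i j
      cycle     : Cycle
      unique    : ∀ D → SameCycle D cycle

record OrientedGraph (n : ℕ) : Set₁ where
  field
    underlying : SimpleGraph n
  open SimpleGraph underlying public
  field
    Arc      : Fin n → Fin n → Set
    arc?     : ∀ u v → Dec (Arc u v)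
    arc⇒edge : ∀ {u v} → Arc u v → Edge u v
    edge⇒arc : ∀ {u v} → Edge u v → Arc u v ⊎ Arc v u
    arc-asym : ∀ {u v} → Arc u v → ¬ Arc v u

-- The values of weight at pairs that are not arcs are irrelevant.
record WeightedOrientedGraph (n : ℕ) : Set₁ where
  field
    graph : OrientedGraph n
  open OrientedGraph graph public
  field
    weight         : Fin n → Fin n → ℂ
    weight-nonzero : ∀ {u v} → Arc u v → Nonzero (weight u v)

module _ {n : ℕ} (G : WeightedOrientedGraph n) where
  open WeightedOrientedGraph G

  entry : ∀ {i j} → Dec (Arc i j) → Dec (Arc j i) → ℂ
  entry {i} {j} (yes _) _       = weight i j
  entry {i} {j} (no _)  (yes _) = conj (weight j i)
  entry {i} {j} (no _)  (no _)  = 0ᶜ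

  a : Fin n → Fin n → ℂ
  a i j = entry (arc? i j) (arc? j i)

  stepsWeight : ∀ {i j} → Star Edge i j → ℂ
  stepsWeight ε                  = 1ᶜ
  stepsWeight (_◅_ {i} {j} _ es) = a i j *ᶜ stepsWeight es

  wt : ∀ {i j} → Walk underlying i j → ℂ
  wt γ = stepsWeight (Walk.steps γ)

  wtCycle : Cycle underlying → ℂ
  wtCycle C = wt walk *ᶜ a end base
    where open Cycle C

  entry-nonzero : ∀ {i j} → Edge i j → (p : Dec (Arc i j)) (q : Dec (Arc j i)) → Nonzero (entry p q)
  entry-nonzero {i} {j} e (yes p) _       = weight-nonzero p
  entry-nonzero {i} {j} e (no _)  (yes q) = conj-nonzero (weight j i) (weight-nonzero q)
  entry-nonzero {i} {j} e (no ¬p) (no ¬q) =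
    [ (λ p → contradiction p ¬p) , (λ q → contradiction q ¬q) ]′ (edge⇒arc e)

  a-nonzero : ∀ {i j} → Edge i j → Nonzero (a i j)
  a-nonzero {i} {j} e = entry-nonzero e (arc? i j) (arc? j i)

  wt-nonzero : ∀ {i j} (γ : Walk underlying i j) → Nonzero (wt γ)
  wt-nonzero γ = go (Walk.steps γ)
    where
    go : ∀ {i j} (es : Star Edge i j) → Nonzero (stepsWeight es)
    go ε = 1ᶜ-nonzero
    go (_◅_ {i} {j} e es) = *ᶜ-nonzero (a i j) (stepsWeight es) (a-nonzero e) (go es)

{-# OPTIONS --safe #-}

-- If the directions of z = wt γ′ and w = wt γ are opposite, then z ≈ - s w with
-- s = |z| / |w| > 0, so z w̄ ≈ - s |w|² is a negative real.  On the other hand,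
-- two distinct paths from i to j run along a common stem, part at a vertex, meet
-- again, and from there agree: a second parting would close up to a second cycle,
-- which avoids the vertex of the first one.  The two sides between parting and
-- meeting make up the unique cycle C.  Since a v u is the conjugate of a u v, the
-- common stem and tail contribute the positive factor |wt stem · wt tail|² to
-- z w̄, and the rest is wt C or its conjugate (or 1 if the paths are equal).

module Submission where

open import Algebra.Bundles using (CommutativeMonoid)
import Algebra.Properties.CommutativeSemigroup as CommutativeSemigroupProperties
open import Algebra.Structures.Biased using (isCommutativeMonoidˡ)
open import Data.Fin.Base using (Fin)
open import Data.Fin.Properties using () renaming (_≟_ to _≟ᶠ_)
open import Data.List.Base using (List; []; _∷_; _++_; [_]; length; map)
open import Data.List.Membership.Propositional using (_∈_; _∉_)
open import Data.List.Membership.Propositional.Properties using (∈-map⁺; ∈-map⁻)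
open import Data.List.Membership.Propositional.Properties.WithK using (unique∧set⇒bag)
open import Data.List.Relation.Binary.BagAndSetEquality using (∼bag⇒↭)
open import Data.List.Relation.Binary.Permutation.Propositional as ↭
  using (_↭_; ↭-refl; ↭-reflexive; ↭-sym; ↭-trans; ↭⇒↭ₛ)
open import Data.List.Relation.Binary.Permutation.Propositional.Properties
  using (∈-resp-↭; ∷↭∷ʳ; ++⁺ˡ; shift)
import Data.List.Relation.Binary.Permutation.Setoid.Properties as Permutationₛ
open import Data.List.Relation.Unary.All as All using (All; []; _∷_)
import Data.List.Relation.Unary.All.Properties as All
open import Data.List.Relation.Unary.AllPairs using ([]; _∷_)
open import Data.List.Relation.Unary.Any using (here; there; any?)
open import Data.List.Relation.Unary.Unique.Propositional using (Unique)
open import Data.List.Relation.Unary.Unique.Propositional.Properties as Unique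
  using (Unique[x∷xs]⇒x∉xs)
open import Data.Nat.Base as ℕ using (ℕ)
import Data.Nat.Properties as ℕ
open import Data.Product.Base using (∃-syntax; _×_; _,_; proj₁; proj₂; swap; uncurry)
open import Data.Rational.Base using (0ℚ; 1ℚ; ½; _≤_; _<_; _+_; _*_; _-_; -_; ∣_∣; nonNegative)
open import Data.Rational.Properties
open import Data.Rational.Solver using (module +-*-Solver)
open import Data.Sum.Base as Sum using (_⊎_; inj₁; inj₂; [_,_]′)
open import Function.Base using (_∘_; flip; id)
open import Function.Bundles using (mk⇔; Equivalence)
open import Level using (0ℓ)
open import Relation.Binary.Construct.Closure.ReflexiveTransitive using (Star; ε; _◅_; _◅◅_)
open import Relation.Binary.PropositionalEquality hiding ([_])
import Relation.Binary.Reasoning.Setoid as ≈-Reasoning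
open import Relation.Nullary using (¬_; Dec; yes; no; contradiction)
open import Defs

open +-*-Solver using (solve; _:+_; _:*_; :-_; _:-_; _:=_; con)

-- Real and complex arithmetic

module _ {x y : ℝ} where

  eventually-≡⇒≈ʳ : ∀ N → (∀ n → N ℕ.≤ n → seq x n ≡ seq y n) → x ≈ʳ y
  eventually-≡⇒≈ʳ N eq = mk≈ʳ λ e 0<e → N , λ n N≤n →
    subst (λ r → ∣ r ∣ ≤ e)
      (sym (trans (cong (_- seq y n) (eq n N≤n)) (+-inverseʳ (seq y n)))) (<⇒≤ 0<e)

  pointwise-≡⇒≈ʳ : (∀ n → seq x n ≡ seq y n) → x ≈ʳ y
  pointwise-≡⇒≈ʳ eq = eventually-≡⇒≈ʳ 0 (λ n _ → eq n)

≈ʳ-refl : ∀ {x} → x ≈ʳ x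
≈ʳ-refl = pointwise-≡⇒≈ʳ (λ _ → refl)

≈ʳ-sym : ∀ {x y} → x ≈ʳ y → y ≈ʳ x
≈ʳ-sym {x} {y} (mk≈ʳ null) = mk≈ʳ λ e 0<e →
  let N , b = null e 0<e
  in N , λ n N≤n → subst (_≤ e) (∣p-q∣≡∣q-p∣ (seq x n) (seq y n)) (b n N≤n)

neg-neg : ∀ p → p ≡ - (- p)
neg-neg = solve 1 (λ p → p := :- (:- p)) refl

telescope : ∀ p q r → (p + q) - (q + r) ≡ p - r
telescope = solve 3 (λ p q r → (p :+ q) :- (q :+ r) := p :- r) refl

≈ʳ-trans : ∀ {x y z} → x ≈ʳ y → y ≈ʳ z → x ≈ʳ z
≈ʳ-trans {x} {y} {z} (mk≈ʳ null₁) (mk≈ʳ null₂) = mk≈ʳ λ e 0<e →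
  let N₁ , b₁ = null₁ (½ * e) (0<* 0<½ 0<e)
      N₂ , b₂ = null₂ (½ * e) (0<* 0<½ 0<e)
  in N₁ ℕ.⊔ N₂ , λ n N≤n →
    let L₁ , L₂ = ⊔-split N₁ N₂ N≤n
    in subst (λ r → ∣ r ∣ ≤ e) (telescope (seq x n) (seq y n) (seq z n))
         (+-close {e} (seq x n) (seq y n) (seq y n) (seq z n) (b₁ n L₁) (b₂ n L₂))

+ʳ-cong : ∀ {x x′ y y′} → x ≈ʳ x′ → y ≈ʳ y′ → x +ʳ y ≈ʳ x′ +ʳ y′
+ʳ-cong {x} {x′} {y} {y′} (mk≈ʳ null₁) (mk≈ʳ null₂) = mk≈ʳ λ e 0<e →
  let N₁ , b₁ = null₁ (½ * e) (0<* 0<½ 0<e)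
      N₂ , b₂ = null₂ (½ * e) (0<* 0<½ 0<e)
  in N₁ ℕ.⊔ N₂ , λ n N≤n →
    let L₁ , L₂ = ⊔-split N₁ N₂ N≤n
    in +-close {e} (seq x n) (seq x′ n) (seq y n) (seq y′ n) (b₁ n L₁) (b₂ n L₂)

-ʳ-cong : ∀ {x y} → x ≈ʳ y → -ʳ x ≈ʳ -ʳ y
-ʳ-cong {x} {y} (mk≈ʳ null) = mk≈ʳ λ e 0<e →
  let N , b = null e 0<e
  in N , λ n N≤n → subst (_≤ e)
       (trans (∣p-q∣≡∣q-p∣ (seq x n) (seq y n)) (cong ∣_∣ (sub-neg (seq x n) (seq y n))))
       (b n N≤n)

*ʳ-cong : ∀ {x x′ y y′} → x ≈ʳ x′ → y ≈ʳ y′ → x *ʳ y ≈ʳ x′ *ʳ y′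
*ʳ-cong {x} {x′} {y} {y′} (mk≈ʳ null₁) (mk≈ʳ null₂) = mk≈ʳ λ e 0<e →
  let B , 0<B , N₁ , bx = bounded (seq x) (cauchy x)
      C , 0<C , N₂ , by = bounded (seq y′) (cauchy y′)
      d  , 0<d  , Bd≡  = divide (½ * e) 0<B (0<* 0<½ 0<e)
      d′ , 0<d′ , Cd′≡ = divide (½ * e) 0<C (0<* 0<½ 0<e)
      N₃ , b₁ = null₁ d′ 0<d′
      N₄ , b₂ = null₂ d 0<d
  in (N₁ ℕ.⊔ N₂) ℕ.⊔ (N₃ ℕ.⊔ N₄) , λ n N≤n →
    let L₁₂ , L₃₄ = ⊔-split (N₁ ℕ.⊔ N₂) (N₃ ℕ.⊔ N₄) N≤n
        L₁ , L₂ = ⊔-split N₁ N₂ L₁₂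
        L₃ , L₄ = ⊔-split N₃ N₄ L₃₄
    in *-close {e} (seq x n) (seq x′ n) (seq y n) (seq y′ n) (<⇒≤ 0<B) (<⇒≤ 0<C) Bd≡ Cd′≡
         (bx n L₁) (by n L₂) (b₁ n L₃) (b₂ n L₄)

0<ʳ-resp-≈ : ∀ {x y} → x ≈ʳ y → 0ʳ <ʳ x → 0ʳ <ʳ y
0<ʳ-resp-≈ {x} {y} (mk≈ʳ null) (mk<ʳ (e , 0<e , N₁ , b)) =
  let N₂ , near = null (½ * e) (0<* 0<½ 0<e)
  in mk<ʳ (½ * e , 0<* 0<½ 0<e , N₁ ℕ.⊔ N₂ , λ n N≤n →
    let L₁ , L₂ = ⊔-split N₁ N₂ N≤n
    in bound (seq x n) (seq y n) (½ * e) (½ * e) (half+half e)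
         (b n L₁) (≤-trans (p≤∣p∣ (seq x n - seq y n)) (near n L₂)))
  where
  open ≤-Reasoning
  lhs : ∀ h h′ → 0ℚ + h ≡ (0ℚ + (h + h′)) + - h′
  lhs = solve 2 (λ h h′ → con 0ℚ :+ h := (con 0ℚ :+ (h :+ h′)) :+ :- h′) refl
  rhs : ∀ p q → p + - (p - q) ≡ q
  rhs = solve 2 (λ p q → p :+ :- (p :- q) := q) refl
  bound : ∀ p q h h′ {e} → h + h′ ≡ e → 0ℚ + e ≤ p → p - q ≤ h′ → 0ℚ + h ≤ q
  bound p q h h′ refl e≤p p-q≤h′ = begin
    0ℚ + h                  ≡⟨ lhs h h′ ⟩
    (0ℚ + (h + h′)) + - h′  ≤⟨ +-mono-≤ e≤p (neg-antimono-≤ p-q≤h′) ⟩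
    p + - (p - q)           ≡⟨ rhs p q ⟩
    q                       ∎

0<ʳ-*ʳ : ∀ {x y} → 0ʳ <ʳ x → 0ʳ <ʳ y → 0ʳ <ʳ x *ʳ y
0<ʳ-*ʳ {x} {y} (mk<ʳ (d , 0<d , N₁ , b₁)) (mk<ʳ (e , 0<e , N₂ , b₂)) =
  mk<ʳ (d * e , 0<* 0<d 0<e , N₁ ℕ.⊔ N₂ , λ n N≤n →
    let L₁ , L₂ = ⊔-split N₁ N₂ N≤n
        d≤x = subst (_≤ seq x n) (+-identityˡ d) (b₁ n L₁)
        e≤y = subst (_≤ seq y n) (+-identityˡ e) (b₂ n L₂)
    in subst (_≤ seq x n * seq y n) (sym (+-identityˡ (d * e)))
         (*-mono-≤₀ (≤-trans (<⇒≤ 0<d) d≤x) (<⇒≤ 0<e) d≤x e≤y))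

0<recipℚ : ∀ {q} → 0ℚ < q → 0ℚ < recipℚ q
0<recipℚ {q} 0<q = subst (0ℚ <_) (*-identityʳ (recipℚ q)) (proj₁ (proj₂ (divide 1ℚ 0<q 0<1)))

recipℚ-antimono : ∀ {p q} → 0ℚ < p → p ≤ q → recipℚ q ≤ recipℚ p
recipℚ-antimono {p} {q} 0<p p≤q = begin
  recipℚ q                     ≡⟨ *-identityˡ (recipℚ q) ⟨
  1ℚ * recipℚ q                ≡⟨ cong (_* recipℚ q) (*-recipℚ 0<p) ⟨
  (p * recipℚ p) * recipℚ q    ≤⟨ *-monoʳ-≤-nonNeg (recipℚ q) {{nonNegative (<⇒≤ (0<recipℚ 0<q))}}
                                    (*-monoʳ-≤-nonNeg (recipℚ p) {{nonNegative (<⇒≤ (0<recipℚ 0<p))}} p≤q) ⟩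
  (q * recipℚ p) * recipℚ q    ≡⟨ cong (_* recipℚ q) (*-comm q (recipℚ p)) ⟩
  (recipℚ p * q) * recipℚ q    ≡⟨ *-assoc (recipℚ p) q (recipℚ q) ⟩
  recipℚ p * (q * recipℚ q)    ≡⟨ cong (recipℚ p *_) (*-recipℚ 0<q) ⟩
  recipℚ p * 1ℚ                ≡⟨ *-identityʳ (recipℚ p) ⟩
  recipℚ p                     ∎
  where
  open ≤-Reasoning
  0<q = <-≤-trans 0<p p≤q

eventually-positive : ∀ {x} (0<x : 0ʳ <ʳ x) → ∀ n → proj₁ (proj₂ (proj₂ (_<ʳ_.gap 0<x))) ℕ.≤ n → 0ℚ < seq x n
eventually-positive {x} (mk<ʳ (d , 0<d , N , b)) n N≤n =
  <-≤-trans 0<d (subst (_≤ seq x n) (+-identityˡ d) (b n N≤n))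

0<ʳ-recip : ∀ x (0<x : 0ʳ <ʳ x) → 0ʳ <ʳ recip x 0<x
0<ʳ-recip x 0<x@(mk<ʳ (_ , _ , N₁ , _)) =
  let B , 0<B , N₂ , bx = bounded (seq x) (cauchy x)
  in mk<ʳ (recipℚ B , 0<recipℚ 0<B , N₁ ℕ.⊔ N₂ , λ n N≤n →
    let L₁ , L₂ = ⊔-split N₁ N₂ N≤n
    in subst (_≤ recipℚ (seq x n)) (sym (+-identityˡ (recipℚ B)))
         (recipℚ-antimono (eventually-positive 0<x n L₁) (≤-trans (p≤∣p∣ (seq x n)) (bx n L₂))))

*ʳ-cancel-recip : ∀ x y (0<x : 0ʳ <ʳ x) → x *ʳ (y *ʳ recip x 0<x) ≈ʳ y
*ʳ-cancel-recip x y 0<x@(mk<ʳ (_ , _ , N , _)) = eventually-≡⇒≈ʳ N λ n N≤n →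
  trans (swap-mul (seq x n) (seq y n) (recipℚ (seq x n)))
    (trans (cong (seq y n *_) (*-recipℚ (eventually-positive 0<x n N≤n))) (*-identityʳ (seq y n)))

<0⇒0<-ʳ : ∀ {x} → x <ʳ 0ʳ → 0ʳ <ʳ -ʳ x
<0⇒0<-ʳ {x} (mk<ʳ (e , 0<e , N , b)) = mk<ʳ (e , 0<e , N , λ n N≤n →
  subst₂ _≤_ (move (seq x n) e) (+-identityˡ (- seq x n)) (+-monoˡ-≤ (- seq x n) (b n N≤n)))
  where
  move : ∀ p e → (p + e) + - p ≡ 0ℚ + e
  move = solve 2 (λ p e → (p :+ e) :+ :- p := con 0ℚ :+ e) refl

0<-⇒<0ʳ : ∀ {x} → 0ʳ <ʳ -ʳ x → x <ʳ 0ʳ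
0<-⇒<0ʳ {x} (mk<ʳ (e , 0<e , N , b)) = mk<ʳ (e , 0<e , N , λ n N≤n →
  subst₂ _≤_ (cong (seq x n +_) (+-identityˡ e)) (+-inverseʳ (seq x n)) (+-monoʳ-≤ (seq x n) (b n N≤n)))

≈ᶜ-refl : ∀ {z} → z ≈ᶜ z
≈ᶜ-refl = mk≈ᶜ ≈ʳ-refl ≈ʳ-refl

≈ᶜ-sym : ∀ {z w} → z ≈ᶜ w → w ≈ᶜ z
≈ᶜ-sym (mk≈ᶜ r i) = mk≈ᶜ (≈ʳ-sym r) (≈ʳ-sym i)

≈ᶜ-trans : ∀ {z w v} → z ≈ᶜ w → w ≈ᶜ v → z ≈ᶜ v
≈ᶜ-trans (mk≈ᶜ r i) (mk≈ᶜ r′ i′) = mk≈ᶜ (≈ʳ-trans r r′) (≈ʳ-trans i i′)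

*ᶜ-cong : ∀ {z z′ w w′} → z ≈ᶜ z′ → w ≈ᶜ w′ → z *ᶜ w ≈ᶜ z′ *ᶜ w′
*ᶜ-cong (mk≈ᶜ r i) (mk≈ᶜ r′ i′) = mk≈ᶜ
  (+ʳ-cong (*ʳ-cong r r′) (-ʳ-cong (*ʳ-cong i i′)))
  (+ʳ-cong (*ʳ-cong r i′) (*ʳ-cong i r′))

conj-cong : ∀ {z w} → z ≈ᶜ w → conj z ≈ᶜ conj w
conj-cong (mk≈ᶜ r i) = mk≈ᶜ r (-ʳ-cong i)

pointwise-≡⇒≈ᶜ : ∀ {z w} → (∀ n → seq (re z) n ≡ seq (re w) n) →
  (∀ n → seq (im z) n ≡ seq (im w) n) → z ≈ᶜ w
pointwise-≡⇒≈ᶜ r i = mk≈ᶜ (pointwise-≡⇒≈ʳ r) (pointwise-≡⇒≈ʳ i)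

*ᶜ-assoc : ∀ z w v → (z *ᶜ w) *ᶜ v ≈ᶜ z *ᶜ (w *ᶜ v)
*ᶜ-assoc z w v = pointwise-≡⇒≈ᶜ
  (λ n → re-eq (seq (re z) n) (seq (im z) n) (seq (re w) n) (seq (im w) n) (seq (re v) n) (seq (im v) n))
  (λ n → im-eq (seq (re z) n) (seq (im z) n) (seq (re w) n) (seq (im w) n) (seq (re v) n) (seq (im v) n))
  where
  re-eq : ∀ a b c d e f → (a * c + - (b * d)) * e + - ((a * d + b * c) * f)
                        ≡ a * (c * e + - (d * f)) + - (b * (c * f + d * e))
  re-eq = solve 6 (λ a b c d e f → (a :* c :+ :- (b :* d)) :* e :+ :- ((a :* d :+ b :* c) :* f)
                        := a :* (c :* e :+ :- (d :* f)) :+ :- (b :* (c :* f :+ d :* e))) refl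
  im-eq : ∀ a b c d e f → (a * c + - (b * d)) * f + (a * d + b * c) * e
                        ≡ a * (c * f + d * e) + b * (c * e + - (d * f))
  im-eq = solve 6 (λ a b c d e f → (a :* c :+ :- (b :* d)) :* f :+ (a :* d :+ b :* c) :* e
                        := a :* (c :* f :+ d :* e) :+ b :* (c :* e :+ :- (d :* f))) refl

*ᶜ-comm : ∀ z w → z *ᶜ w ≈ᶜ w *ᶜ z
*ᶜ-comm z w = pointwise-≡⇒≈ᶜ
  (λ n → re-eq (seq (re z) n) (seq (im z) n) (seq (re w) n) (seq (im w) n))
  (λ n → im-eq (seq (re z) n) (seq (im z) n) (seq (re w) n) (seq (im w) n))
  where
  re-eq : ∀ a b c d → a * c + - (b * d) ≡ c * a + - (d * b)
  re-eq = solve 4 (λ a b c d → a :* c :+ :- (b :* d) := c :* a :+ :- (d :* b)) refl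
  im-eq : ∀ a b c d → a * d + b * c ≡ c * b + d * a
  im-eq = solve 4 (λ a b c d → a :* d :+ b :* c := c :* b :+ d :* a) refl

*ᶜ-identityˡ : ∀ z → 1ᶜ *ᶜ z ≈ᶜ z
*ᶜ-identityˡ z = pointwise-≡⇒≈ᶜ
  (λ n → re-eq (seq (re z) n) (seq (im z) n)) (λ n → im-eq (seq (re z) n) (seq (im z) n))
  where
  re-eq : ∀ a b → 1ℚ * a + - (0ℚ * b) ≡ a
  re-eq = solve 2 (λ a b → con 1ℚ :* a :+ :- (con 0ℚ :* b) := a) refl
  im-eq : ∀ a b → 1ℚ * b + 0ℚ * a ≡ b
  im-eq = solve 2 (λ a b → con 1ℚ :* b :+ con 0ℚ :* a := b) refl

conj-*ᶜ : ∀ z w → conj (z *ᶜ w) ≈ᶜ conj z *ᶜ conj w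
conj-*ᶜ z w = pointwise-≡⇒≈ᶜ
  (λ n → re-eq (seq (re z) n) (seq (im z) n) (seq (re w) n) (seq (im w) n))
  (λ n → im-eq (seq (re z) n) (seq (im z) n) (seq (re w) n) (seq (im w) n))
  where
  re-eq : ∀ a b c d → a * c + - (b * d) ≡ a * c + - ((- b) * (- d))
  re-eq = solve 4 (λ a b c d → a :* c :+ :- (b :* d) := a :* c :+ :- ((:- b) :* (:- d))) refl
  im-eq : ∀ a b c d → - (a * d + b * c) ≡ a * (- d) + (- b) * c
  im-eq = solve 4 (λ a b c d → :- (a :* d :+ b :* c) := a :* (:- d) :+ (:- b) :* c) refl

conj-involutive : ∀ z → z ≈ᶜ conj (conj z)
conj-involutive z = pointwise-≡⇒≈ᶜ (λ _ → refl) (λ n → neg-neg (seq (im z) n))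

*ᶜ-1-commutativeMonoid : CommutativeMonoid 0ℓ 0ℓ
*ᶜ-1-commutativeMonoid = record
  { Carrier = ℂ
  ; _≈_ = _≈ᶜ_
  ; _∙_ = _*ᶜ_
  ; ε = 1ᶜ
  ; isCommutativeMonoid = isCommutativeMonoidˡ record
    { isSemigroup = record
      { isMagma = record
        { isEquivalence = record { refl = ≈ᶜ-refl ; sym = ≈ᶜ-sym ; trans = ≈ᶜ-trans }
        ; ∙-cong = *ᶜ-cong
        }
      ; assoc = *ᶜ-assoc
      }
    ; identityˡ = *ᶜ-identityˡ
    ; comm = *ᶜ-comm
    }
  }

NegativeReal-resp-≈ : ∀ {z w} → z ≈ᶜ w → NegativeReal z → NegativeReal w
NegativeReal-resp-≈ (mk≈ᶜ r i) (re<0 , im≈0) =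
  0<-⇒<0ʳ (0<ʳ-resp-≈ (-ʳ-cong r) (<0⇒0<-ʳ re<0)) , ≈ʳ-trans (≈ʳ-sym i) im≈0

NegativeReal-conj : ∀ {z} → NegativeReal (conj z) → NegativeReal z
NegativeReal-conj {z} (re<0 , im≈0) = re<0 ,
  ≈ʳ-trans (pointwise-≡⇒≈ʳ (λ n → neg-neg (seq (im z) n))) (≈ʳ-trans (-ʳ-cong im≈0) (pointwise-≡⇒≈ʳ λ _ → refl))

1ᶜ-notNegativeReal : ¬ NegativeReal 1ᶜ
1ᶜ-notNegativeReal (mk<ʳ (e , 0<e , N , b) , _) = <-irrefl refl (begin-strict
  1ℚ       ≡⟨ +-identityʳ 1ℚ ⟨
  1ℚ + 0ℚ  <⟨ +-monoʳ-< 1ℚ 0<e ⟩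
  1ℚ + e   ≤⟨ b N ℕ.≤-refl ⟩
  0ℚ       <⟨ 0<1 ⟩
  1ℚ       ∎)
  where
  open ≤-Reasoning

0<normSq : ∀ z → Nonzero z → 0ʳ <ʳ normSq z
0<normSq z z≠0 = 0<ʳ-resp-≈ (modulus² z) (0<ʳ-*ʳ z≠0 z≠0)

NegativeReal-cancel : ∀ x t → Nonzero x → NegativeReal ((x *ᶜ conj x) *ᶜ t) → NegativeReal t
NegativeReal-cancel x t x≠0 (re<0 , im≈0) =
  0<-⇒<0ʳ (0<ʳ-resp-≈ (≈ʳ-trans (pointwise-≡⇒≈ʳ re-eq) (*ʳ-cancel-recip c (-ʳ re t) 0<c))
    (0<ʳ-*ʳ (0<ʳ-recip c 0<c) (<0⇒0<-ʳ re<0))) ,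
  ≈ʳ-trans (≈ʳ-sym (*ʳ-cancel-recip c (im t) 0<c)) (≈ʳ-trans (pointwise-≡⇒≈ʳ im-eq)
    (≈ʳ-trans (*ʳ-cong (≈ʳ-refl {recip c 0<c}) im≈0) (pointwise-≡⇒≈ʳ λ n → *-zeroʳ (recipℚ (seq c n)))))
  where
  c = normSq x
  0<c = 0<normSq x x≠0
  re-eq′ : ∀ a b r i k → k * - ((a * a + - (b * - b)) * r + - ((a * - b + b * a) * i))
         ≡ (a * a + b * b) * ((- r) * k)
  re-eq′ = solve 5 (λ a b r i k → k :* :- ((a :* a :+ :- (b :* :- b)) :* r :+ :- ((a :* :- b :+ b :* a) :* i))
         := (a :* a :+ b :* b) :* ((:- r) :* k)) refl
  im-eq′ : ∀ a b r i k → (a * a + b * b) * (i * k) ≡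
         k * ((a * a + - (b * - b)) * i + (a * - b + b * a) * r)
  im-eq′ = solve 5 (λ a b r i k → (a :* a :+ b :* b) :* (i :* k) :=
         k :* ((a :* a :+ :- (b :* :- b)) :* i :+ (a :* :- b :+ b :* a) :* r)) refl
  re-eq = λ n → re-eq′ (seq (re x) n) (seq (im x) n) (seq (re t) n) (seq (im t) n) (recipℚ (seq c n))
  im-eq = λ n → im-eq′ (seq (re x) n) (seq (im x) n) (seq (re t) n) (seq (im t) n) (recipℚ (seq c n))

opposite-directions : ∀ z w (z≠0 : Nonzero z) (w≠0 : Nonzero w) →
  direction z z≠0 ≈ᶜ -ᶜ direction w w≠0 → NegativeReal (z *ᶜ conj w)
opposite-directions z w z≠0 w≠0 (mk≈ᶜ re≈ im≈) =
  0<-⇒<0ʳ (0<ʳ-resp-≈ (-ʳ-cong (≈ʳ-sym (≈ʳ-trans (_≈ᶜ_.re≈ zw̄≈) (pointwise-≡⇒≈ʳ {y = -ʳ (s *ʳ normSq w)} λ n →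
      re-eq (seq s n) (seq (re w) n) (seq (im w) n)))))
    (0<ʳ-resp-≈ (pointwise-≡⇒≈ʳ λ n → neg-neg (seq (s *ʳ normSq w) n))
      (0<ʳ-*ʳ (0<ʳ-*ʳ z≠0 (0<ʳ-recip (modulus w) w≠0)) (0<normSq w w≠0)))) ,
  ≈ʳ-trans (_≈ᶜ_.im≈ zw̄≈) (pointwise-≡⇒≈ʳ λ n → im-eq (seq s n) (seq (re w) n) (seq (im w) n))
  where
  s = modulus z *ʳ recip (modulus w) w≠0
  re-eq : ∀ s a b → - (s * a) * a + - (- (s * b) * - b) ≡ - (s * (a * a + b * b))
  re-eq = solve 3 (λ s a b → :- (s :* a) :* a :+ :- (:- (s :* b) :* :- b) := :- (s :* (a :* a :+ b :* b))) refl
  im-eq : ∀ s a b → - (s * a) * - b + - (s * b) * a ≡ 0ℚ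
  im-eq = solve 3 (λ s a b → :- (s :* a) :* :- b :+ :- (s :* b) :* a := con 0ℚ) refl
  rearrange : ∀ m p k → m * - (p * k) ≡ - ((m * k) * p)
  rearrange = solve 3 (λ m p k → m :* :- (p :* k) := :- ((m :* k) :* p)) refl
  component : ∀ {x y} → x *ʳ recip (modulus z) z≠0 ≈ʳ -ʳ (y *ʳ recip (modulus w) w≠0) → x ≈ʳ -ʳ (s *ʳ y)
  component {x} {y} eq = ≈ʳ-trans (≈ʳ-sym (*ʳ-cancel-recip (modulus z) x z≠0))
    (≈ʳ-trans (*ʳ-cong (≈ʳ-refl {modulus z}) eq)
      (pointwise-≡⇒≈ʳ λ n → rearrange (seq (modulus z) n) (seq y n) (recipℚ (seq (modulus w) n))))
  zw̄≈ : z *ᶜ conj w ≈ᶜ ((-ʳ (s *ʳ re w)) +i (-ʳ (s *ʳ im w))) *ᶜ conj w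
  zw̄≈ = *ᶜ-cong (mk≈ᶜ (component re≈) (component im≈)) (≈ᶜ-refl {conj w})

-- Paths and cycles

Unique-map⇒injectiveOn : ∀ {A B : Set} {f : A → B} {xs x y} → Unique (map f xs) →
  x ∈ xs → y ∈ xs → f x ≡ f y → x ≡ y
Unique-map⇒injectiveOn _ (here refl) (here refl) _ = refl
Unique-map⇒injectiveOn {f = f} {_ ∷ xs} u (here refl) (there y∈) eq =
  contradiction (subst (_∈ map f xs) (sym eq) (∈-map⁺ f y∈)) (Unique[x∷xs]⇒x∉xs u)
Unique-map⇒injectiveOn {f = f} {_ ∷ xs} u (there x∈) (here refl) eq =
  contradiction (subst (_∈ map f xs) eq (∈-map⁺ f x∈)) (Unique[x∷xs]⇒x∉xs u)
Unique-map⇒injectiveOn (_ ∷ u) (there x∈) (there y∈) eq = Unique-map⇒injectiveOn u x∈ y∈ eq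

Unique-∷ : ∀ {A : Set} {x : A} {xs} → x ∉ xs → Unique xs → Unique (x ∷ xs)
Unique-∷ x∉xs u = All.¬Any⇒All¬ _ x∉xs ∷ u

∈-swap⁺ : ∀ {A : Set} {u v : A} {xs} → (u , v) ∈ xs → (v , u) ∈ map swap xs
∈-swap⁺ = ∈-map⁺ swap

∈-swap⁻ : ∀ {A : Set} {u v : A} {xs} → (u , v) ∈ map swap xs → (v , u) ∈ xs
∈-swap⁻ uv∈ with ∈-map⁻ swap uv∈
... | _ , vu∈ , refl = vu∈

module Paths {n : ℕ} (H : SimpleGraph n) where
  open SimpleGraph H

  V : ∀ {i j} → Star Edge i j → List (Fin n)
  V = vertices H

  E : ∀ {i j} → Star Edge i j → List (Fin n × Fin n)
  E = edges H

  vertices-targets : ∀ {i j} (es : Star Edge i j) → V es ≡ i ∷ map proj₂ (E es)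
  vertices-targets ε        = refl
  vertices-targets (_ ◅ es) = cong (_ ∷_) (vertices-targets es)

  vertices-sources : ∀ {i j} (es : Star Edge i j) → V es ≡ map proj₁ (E es) ++ [ j ]
  vertices-sources ε        = refl
  vertices-sources (_ ◅ es) = cong (_ ∷_) (vertices-sources es)

  start∈vertices : ∀ {i j} (es : Star Edge i j) → i ∈ V es
  start∈vertices ε       = here refl
  start∈vertices (_ ◅ _) = here refl

  end∈vertices : ∀ {i j} (es : Star Edge i j) → j ∈ V es
  end∈vertices ε        = here refl
  end∈vertices (_ ◅ es) = there (end∈vertices es)

  edges-Edge : ∀ {i j} (es : Star Edge i j) → All (uncurry Edge) (E es)
  edges-Edge ε        = []
  edges-Edge (e ◅ es) = e ∷ edges-Edge es

  edges-◅◅ : ∀ {i j k} (es : Star Edge i j) (fs : Star Edge j k) → E (es ◅◅ fs) ≡ E es ++ E fs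
  edges-◅◅ ε        fs = refl
  edges-◅◅ (_ ◅ es) fs = cong (_ ∷_) (edges-◅◅ es fs)

  module _ {v : Fin n} where

    ∈-◅◅⁺ˡ : ∀ {i j k} {es : Star Edge i j} (fs : Star Edge j k) → v ∈ V es → v ∈ V (es ◅◅ fs)
    ∈-◅◅⁺ˡ {es = ε}      fs (here refl) = start∈vertices fs
    ∈-◅◅⁺ˡ {es = _ ◅ es} fs (here refl) = here refl
    ∈-◅◅⁺ˡ {es = _ ◅ es} fs (there v∈)  = there (∈-◅◅⁺ˡ {es = es} fs v∈)

    ∈-◅◅⁺ʳ : ∀ {i j k} (es : Star Edge i j) {fs : Star Edge j k} → v ∈ V fs → v ∈ V (es ◅◅ fs)
    ∈-◅◅⁺ʳ ε        v∈ = v∈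
    ∈-◅◅⁺ʳ (_ ◅ es) v∈ = there (∈-◅◅⁺ʳ es v∈)

    ∈-◅◅⁻ : ∀ {i j k} (es : Star Edge i j) {fs : Star Edge j k} → v ∈ V (es ◅◅ fs) → v ∈ V es ⊎ v ∈ V fs
    ∈-◅◅⁻ ε        v∈          = inj₂ v∈
    ∈-◅◅⁻ (_ ◅ es) (here refl) = inj₁ (here refl)
    ∈-◅◅⁻ (_ ◅ es) (there v∈)  = Sum.map₁ there (∈-◅◅⁻ es v∈)

  Unique-◅◅⁻ˡ : ∀ {i j k} (es : Star Edge i j) {fs : Star Edge j k} → Unique (V (es ◅◅ fs)) → Unique (V es)
  Unique-◅◅⁻ˡ ε             _         = [] ∷ []
  Unique-◅◅⁻ˡ (_ ◅ es) {fs} u@(_ ∷ u′) =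
    Unique-∷ (Unique[x∷xs]⇒x∉xs u ∘ ∈-◅◅⁺ˡ {es = es} fs) (Unique-◅◅⁻ˡ es u′)

  Unique-◅◅⁻ʳ : ∀ {i j k} (es : Star Edge i j) {fs : Star Edge j k} → Unique (V (es ◅◅ fs)) → Unique (V fs)
  Unique-◅◅⁻ʳ ε        u       = u
  Unique-◅◅⁻ʳ (_ ◅ es) (_ ∷ u) = Unique-◅◅⁻ʳ es u

  Unique-◅◅⁺ : ∀ {i j k} (es : Star Edge i j) {fs : Star Edge j k} → Unique (V es) → Unique (V fs) →
    (∀ {v} → v ∈ V es → v ∈ V fs → v ≡ j) → Unique (V (es ◅◅ fs))
  Unique-◅◅⁺ ε        _          uf _    = uf
  Unique-◅◅⁺ (_ ◅ es) u@(_ ∷ ue) uf meet = Unique-∷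
    (λ i∈ → [ i∉es , (λ i∈fs → i∉es (subst (_∈ V es) (sym (meet (here refl) i∈fs)) (end∈vertices es))) ]′
      (∈-◅◅⁻ es i∈))
    (Unique-◅◅⁺ es ue uf (meet ∘ there))
    where i∉es = Unique[x∷xs]⇒x∉xs u

  rev : ∀ {i j} → Star Edge i j → Star Edge j i
  rev ε        = ε
  rev (e ◅ es) = rev es ◅◅ (edge-sym e ◅ ε)

  edges-rev : ∀ {i j} (es : Star Edge i j) → E (rev es) ↭ map swap (E es)
  edges-rev ε        = ↭-refl
  edges-rev (e ◅ es) = ↭-trans (↭-reflexive (edges-◅◅ (rev es) _))
    (↭-trans (↭-sym (∷↭∷ʳ _ (E (rev es)))) (↭.prep _ (edges-rev es)))

  ∈-rev⁻ : ∀ {i j v} (es : Star Edge i j) → v ∈ V (rev es) → v ∈ V es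
  ∈-rev⁻ ε        v∈ = v∈
  ∈-rev⁻ (e ◅ es) v∈ with ∈-◅◅⁻ (rev es) v∈
  ... | inj₁ v∈es                = there (∈-rev⁻ es v∈es)
  ... | inj₂ (here refl)         = there (start∈vertices es)
  ... | inj₂ (there (here refl)) = here refl

  Unique-rev : ∀ {i j} (es : Star Edge i j) → Unique (V es) → Unique (V (rev es))
  Unique-rev ε                  u          = u
  Unique-rev (_◅_ {i} {k} e es) u@(_ ∷ ue) = Unique-◅◅⁺ (rev es) (Unique-rev es ue)
    (Unique-∷ (λ { (here refl) → i∉es (start∈vertices es) }) ([] ∷ []))
    λ { _    (here eq)            → eq
      ; v∈es (there (here refl)) → contradiction (∈-rev⁻ es v∈es) i∉es }
    where i∉es = Unique[x∷xs]⇒x∉xs u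

  record FirstHit (L : List (Fin n)) {i j} (es : Star Edge i j) : Set where
    constructor firstHit
    field
      {hit}  : Fin n
      before : Star Edge i hit
      after  : Star Edge hit j
      split  : es ≡ before ◅◅ after
      hit∈L  : hit ∈ L
      first  : ∀ {v} → v ∈ V before → v ∈ L → v ≡ hit

  findFirstHit : ∀ L {i j} (es : Star Edge i j) → j ∈ L → FirstHit L es
  findFirstHit L ε j∈L = firstHit ε ε refl j∈L λ { (here eq) _ → eq }
  findFirstHit L {i} (e ◅ es) j∈L with any? (i ≟ᶠ_) L
  ... | yes i∈L = firstHit ε (e ◅ es) refl i∈L λ { (here eq) _ → eq }
  ... | no  i∉L with findFirstHit L es j∈L
  ...   | firstHit before after refl hit∈L first = firstHit (e ◅ before) after refl hit∈L
    λ { (here refl) i∈L → contradiction i∈L i∉L ; (there v∈) → first v∈ }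

  splitAt : ∀ {i j v} (es : Star Edge i j) → v ∈ V es →
    ∃[ before ] ∃[ after ] es ≡ _◅◅_ {j = v} before after
  splitAt ε        (here refl) = ε , ε , refl
  splitAt (e ◅ es) (here refl) = ε , e ◅ es , refl
  splitAt (e ◅ es) (there v∈) with splitAt es v∈
  ... | before , after , refl = e ◅ before , after , refl

  traversal : Cycle H → List (Fin n × Fin n)
  traversal C = (Cycle.end C , Cycle.base C) ∷ E (Walk.steps (Cycle.walk C))

  module _ (C : Cycle H) where
    open Cycle C
    open Walk walk

    traversal-targets : map proj₂ (traversal C) ≡ V steps
    traversal-targets = sym (vertices-targets steps)

    traversal-sources : map proj₁ (traversal C) ↭ V steps
    traversal-sources = ↭-trans (∷↭∷ʳ end _) (↭-reflexive (sym (vertices-sources steps)))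

    traversal-ends : ∀ {u v} → (u , v) ∈ traversal C → u ∈ V steps × v ∈ V steps
    traversal-ends uv∈ = ∈-resp-↭ traversal-sources (∈-map⁺ proj₁ uv∈) ,
      subst (_ ∈_) traversal-targets (∈-map⁺ proj₂ uv∈)

    Unique-targets : Unique (map proj₂ (traversal C))
    Unique-targets = subst Unique (sym traversal-targets) distinct

    Unique-sources : Unique (map proj₁ (traversal C))
    Unique-sources = Permutationₛ.Unique-resp-↭ (setoid (Fin n)) (↭⇒↭ₛ (↭-sym traversal-sources)) distinct

    Unique-traversal : Unique (traversal C)
    Unique-traversal = Unique.map⁻ Unique-sources

    traversal-injective : ∀ {u v w} → (u , w) ∈ traversal C → (v , w) ∈ traversal C → u ≡ v
    traversal-injective uw∈ vw∈ = cong proj₁ (Unique-map⇒injectiveOn Unique-targets uw∈ vw∈ refl)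

    traversal-functional : ∀ {u v w} → (u , v) ∈ traversal C → (u , w) ∈ traversal C → v ≡ w
    traversal-functional uv∈ uw∈ = cong proj₂ (Unique-map⇒injectiveOn Unique-sources uv∈ uw∈ refl)

  edges-sources∈ : ∀ {i j u v} (es : Star Edge i j) → (u , v) ∈ E es → u ∈ V es
  edges-sources∈ (_ ◅ es) (here refl) = here refl
  edges-sources∈ (_ ◅ es) (there uv∈) = there (edges-sources∈ es uv∈)

  edges-targets∈ : ∀ {i j u v} (es : Star Edge i j) → (u , v) ∈ E es → v ∈ V es
  edges-targets∈ (_ ◅ es) (here refl) = there (start∈vertices es)
  edges-targets∈ (_ ◅ es) (there uv∈) = there (edges-targets∈ es uv∈)

  edges-asym : ∀ {i j u v} (es : Star Edge i j) → Unique (V es) → (u , v) ∈ E es → (v , u) ∉ E es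
  edges-asym (e ◅ es) u       (here refl) (here refl) = edge-irrefl e
  edges-asym (_ ◅ es) u       (here refl) (there vu∈) = Unique[x∷xs]⇒x∉xs u (edges-targets∈ es vu∈)
  edges-asym (_ ◅ es) u       (there uv∈) (here refl) = Unique[x∷xs]⇒x∉xs u (edges-targets∈ es uv∈)
  edges-asym (_ ◅ es) (_ ∷ u) (there uv∈) (there vu∈) = edges-asym es u uv∈ vu∈

  chord∉edges : ∀ {i j} (es : Star Edge i j) → Unique (V es) → 3 ℕ.≤ length (V es) → (i , j) ∉ E es
  chord∉edges (_ ◅ ε)      _           (ℕ.s≤s (ℕ.s≤s ()))
  chord∉edges (_ ◅ _ ◅ es) (_ ∷ u)     _ (here refl) = Unique[x∷xs]⇒x∉xs u (end∈vertices es)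
  chord∉edges (_ ◅ es)     u           _ (there ij∈) = Unique[x∷xs]⇒x∉xs u (edges-sources∈ es ij∈)

  traversal-asym : ∀ C {u v} → (u , v) ∈ traversal C → (v , u) ∉ traversal C
  traversal-asym C (here refl) (here refl) = edge-irrefl (Cycle.closing C)
  traversal-asym C (here refl) (there vu∈) =
    chord∉edges (Walk.steps (Cycle.walk C)) (Walk.distinct (Cycle.walk C)) (Cycle.long C) vu∈
  traversal-asym C (there uv∈) (here refl) =
    chord∉edges (Walk.steps (Cycle.walk C)) (Walk.distinct (Cycle.walk C)) (Cycle.long C) uv∈
  traversal-asym C (there uv∈) (there vu∈) =
    edges-asym (Walk.steps (Cycle.walk C)) (Walk.distinct (Cycle.walk C)) uv∈ vu∈

  module _ (R : Fin n → Fin n → Set) (R-injective : ∀ {u v w} → R u w → R v w → u ≡ v) where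

    -- A path never turns back, so its direction relative to R cannot change.
    path-oriented : ∀ {h i j} (es : Star Edge i j) → R h i → h ∉ V es → Unique (V es) →
      All (λ (u , v) → R u v ⊎ R v u) (E es) → All (uncurry R) (E es)
    path-oriented ε        _   _    _          _              = []
    path-oriented (_ ◅ es) Rhi h∉   u@(_ ∷ u′) (inj₁ Rik ∷ rs) =
      Rik ∷ path-oriented es Rik (Unique[x∷xs]⇒x∉xs u) u′ rs
    path-oriented (_ ◅ es) Rhi h∉   _          (inj₂ Rki ∷ _)  =
      contradiction (there (subst (_∈ V es) (R-injective Rki Rhi) (start∈vertices es))) h∉

    module _ (R-functional : ∀ {u v w} → R u v → R u w → v ≡ w) where

      closed-path-oriented : ∀ {i k l j} (e : Edge i k) (f : Edge k l) (es : Star Edge l j) →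
        Unique (V (e ◅ f ◅ es)) → R i k → R j i ⊎ R i j →
        All (λ (u , v) → R u v ⊎ R v u) (E (f ◅ es)) →
        All (uncurry R) ((j , i) ∷ E (e ◅ f ◅ es))
      closed-path-oriented e f es u@(_ ∷ u′) Rik (inj₁ Rji) rs =
        Rji ∷ Rik ∷ path-oriented (f ◅ es) Rik (Unique[x∷xs]⇒x∉xs u) u′ rs
      closed-path-oriented e f es (_ ∷ u) Rik (inj₂ Rij) _ =
        contradiction (subst (_∈ V es) (R-functional Rij Rik) (end∈vertices es)) (Unique[x∷xs]⇒x∉xs u)

  module _ (R : Fin n → Fin n → Set) (R-injective : ∀ {u v w} → R u w → R v w → u ≡ v)
           (R-functional : ∀ {u v w} → R u v → R u w → v ≡ w) where

    cycle-oriented : ∀ C → All (λ (u , v) → R u v ⊎ R v u) (traversal C) →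
      All (uncurry R) (traversal C) ⊎ All (uncurry (flip R)) (traversal C)
    cycle-oriented record { walk = record { steps = ε } ; long = ℕ.s≤s () }
    cycle-oriented record { walk = record { steps = _ ◅ ε } ; long = ℕ.s≤s (ℕ.s≤s ()) }
    cycle-oriented record { walk = record { steps = e ◅ f ◅ es ; distinct = u } } (r ∷ inj₁ Rik ∷ rs) =
      inj₁ (closed-path-oriented R R-injective R-functional e f es u Rik r rs)
    cycle-oriented record { walk = record { steps = e ◅ f ◅ es ; distinct = u } } (r ∷ inj₂ Rki ∷ rs) =
      inj₂ (closed-path-oriented (flip R) R-functional R-injective e f es u Rki (Sum.swap r) (All.map Sum.swap rs))

  Unique∧⇔⇒↭ : ∀ {xs ys : List (Fin n × Fin n)} → Unique xs → Unique ys →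
    (∀ {z} → z ∈ xs → z ∈ ys) → (∀ {z} → z ∈ ys → z ∈ xs) → xs ↭ ys
  Unique∧⇔⇒↭ ux uy to from = ∼bag⇒↭ (unique∧set⇒bag ux uy (mk⇔ to from))

  sameCycle⇒traversal-↭ : ∀ C D → SameCycle H C D →
    traversal C ↭ traversal D ⊎ traversal C ↭ map swap (traversal D)
  sameCycle⇒traversal-↭ C D same with cycle-oriented (λ u v → (u , v) ∈ traversal D)
      (traversal-injective D) (traversal-functional D) C
      (All.tabulate λ uv∈ → Equivalence.to (same _ _) (inj₁ uv∈))
  ... | inj₁ C⊆D = inj₁ (Unique∧⇔⇒↭ (Unique-traversal C) (Unique-traversal D) (All.lookup C⊆D)
    λ uv∈ → [ id , (λ vu∈C → contradiction (All.lookup C⊆D vu∈C) (traversal-asym D uv∈)) ]′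
      (Equivalence.from (same _ _) (inj₁ uv∈)))
  ... | inj₂ C⊆D = inj₂ (Unique∧⇔⇒↭ (Unique-traversal C)
    (Unique.map⁺ (cong swap) (Unique-traversal D)) (∈-swap⁺ ∘ All.lookup C⊆D)
    λ uv∈ → [ id , (λ vu∈C → contradiction (∈-swap⁻ uv∈) (traversal-asym D (All.lookup C⊆D vu∈C))) ]′
      (Sum.swap (Equivalence.from (same _ _) (inj₁ (∈-swap⁻ uv∈)))))

  -- Two paths that part at the vertex fork and next meet where tail₁ and tail₂ start.
  record Theta {i j} (p q : Star Edge i j) : Set where
    field
      {fork next meet} : Fin n
      stem side₁ side₂ : List (Fin n × Fin n)
      tail₁ tail₂      : Star Edge meet j
      edges₁           : E p ≡ stem ++ (side₁ ++ E tail₁)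
      edges₂           : E q ≡ stem ++ (side₂ ++ E tail₂)
      unique₁          : Unique (V tail₁)
      unique₂          : Unique (V tail₂)
      fork∉tail₁       : fork ∉ V tail₁
      fork∉tail₂       : fork ∉ V tail₂
      cycle            : Cycle H
      sides            : side₁ ++ map swap side₂ ↭ traversal cycle
      fork∈cycle       : (next , fork) ∈ traversal cycle
      cycle⊆           : ∀ {v} → v ∈ V (Walk.steps (Cycle.walk cycle)) → v ∈ V p ⊎ v ∈ V q

  2≤length : ∀ {i j} (es : Star Edge i j) → i ≢ j → 2 ℕ.≤ length (V es)
  2≤length ε            i≢i = contradiction refl i≢i
  2≤length (_ ◅ ε)      _   = ℕ.s≤s (ℕ.s≤s ℕ.z≤n)
  2≤length (_ ◅ _ ◅ es) _   = ℕ.s≤s (ℕ.s≤s ℕ.z≤n)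

  fork-theta : ∀ {x u z j} (e : Edge x u) (p : Star Edge u j) (f : Edge x z) (q : Star Edge z j) →
    Unique (V (e ◅ p)) → Unique (V (f ◅ q)) → u ≢ z → Theta (e ◅ p) (f ◅ q)
  fork-theta {x} {u} {z} e p f q up uq u≢z with findFirstHit (V q) p (end∈vertices q)
  ... | firstHit p₁ p₂ refl y∈q first with splitAt q y∈q
  ...   | q₁ , q₂ , refl = record
    { stem       = []
    ; side₁      = (x , u) ∷ E p₁
    ; side₂      = (x , z) ∷ E q₁
    ; tail₁      = p₂
    ; tail₂      = q₂
    ; edges₁     = cong (_ ∷_) (edges-◅◅ p₁ p₂)
    ; edges₂     = cong (_ ∷_) (edges-◅◅ q₁ q₂)
    ; unique₁    = Unique-◅◅⁻ʳ (e ◅ p₁) up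
    ; unique₂    = Unique-◅◅⁻ʳ (f ◅ q₁) uq
    ; fork∉tail₁ = x∉p ∘ ∈-◅◅⁺ʳ p₁
    ; fork∉tail₂ = x∉q ∘ ∈-◅◅⁺ʳ q₁
    ; cycle      = record
      { base    = x
      ; end     = z
      ; walk    = record
        { steps    = e ◅ around
        ; distinct = Unique-∷
            ([ x∉p , x∉q ]′ ∘ around⊆)
            (Unique-◅◅⁺ p₁ (Unique-◅◅⁻ˡ p₁ (tail up)) (Unique-rev q₁ (Unique-◅◅⁻ˡ q₁ (tail uq)))
              (λ v∈p₁ v∈q₁ → first v∈p₁ (∈q v∈q₁)))
        }
      ; closing = edge-sym f
      ; long    = ℕ.s≤s (2≤length around u≢z)
      }
    ; sides      = ↭-trans (shift (z , x) ((x , u) ∷ E p₁) (map swap (E q₁)))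
        (↭.prep _ (↭.prep _ (↭-trans (++⁺ˡ (E p₁) (↭-sym (edges-rev q₁)))
          (↭-reflexive (sym (edges-◅◅ p₁ (rev q₁)))))))
    ; fork∈cycle = here refl
    ; cycle⊆     = λ { (here eq) → inj₁ (here eq)
                     ; (there v∈) → Sum.map there there (around⊆ v∈) }
    }
    where
    x∉p = Unique[x∷xs]⇒x∉xs up
    x∉q = Unique[x∷xs]⇒x∉xs uq
    around : Star Edge u z
    around = p₁ ◅◅ rev q₁
    tail : ∀ {x : Fin n} {xs} → Unique (x ∷ xs) → Unique xs
    tail (_ ∷ u) = u
    ∈q : ∀ {v} → v ∈ V (rev q₁) → v ∈ V (q₁ ◅◅ q₂)
    ∈q v∈ = ∈-◅◅⁺ˡ {es = q₁} q₂ (∈-rev⁻ q₁ v∈)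
    around⊆ : ∀ {v} → v ∈ V around → v ∈ V (p₁ ◅◅ p₂) ⊎ v ∈ V (q₁ ◅◅ q₂)
    around⊆ v∈ = Sum.map (∈-◅◅⁺ˡ {es = p₁} p₂) ∈q (∈-◅◅⁻ p₁ v∈)

  equal-or-theta : ∀ {i j} (p q : Star Edge i j) → Unique (V p) → Unique (V q) → E p ≡ E q ⊎ Theta p q
  equal-or-theta ε        ε        _  _  = inj₁ refl
  equal-or-theta ε        (_ ◅ q)  _  uq = contradiction (end∈vertices q) (Unique[x∷xs]⇒x∉xs uq)
  equal-or-theta (_ ◅ p)  ε        up _  = contradiction (end∈vertices p) (Unique[x∷xs]⇒x∉xs up)
  equal-or-theta (_◅_ {x} {u} e p) (_◅_ {x} {z} f q) up@(_ ∷ up′) uq@(_ ∷ uq′) with u ≟ᶠ z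
  ... | no  u≢z  = inj₂ (fork-theta e p f q up uq u≢z)
  ... | yes refl = Sum.map (cong ((x , u) ∷_)) extend (equal-or-theta p q up′ uq′)
    where
    extend : Theta p q → Theta (e ◅ p) (f ◅ q)
    extend θ = record
      { stem       = (x , u) ∷ stem
      ; side₁      = side₁
      ; side₂      = side₂
      ; tail₁      = tail₁
      ; tail₂      = tail₂
      ; edges₁     = cong (_ ∷_) edges₁
      ; edges₂     = cong (_ ∷_) edges₂
      ; unique₁    = unique₁
      ; unique₂    = unique₂
      ; fork∉tail₁ = fork∉tail₁
      ; fork∉tail₂ = fork∉tail₂
      ; cycle      = cycle
      ; sides      = sides
      ; fork∈cycle = fork∈cycle
      ; cycle⊆     = Sum.map there there ∘ cycle⊆
      }
      where open Theta θ

  module _ (U : Unicyclic H) where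
    open Unicyclic U using (unique) renaming (cycle to C)

    -- A second theta would give a cycle avoiding the vertex fork of the first.
    tails-agree : ∀ {i j} {p q : Star Edge i j} (θ : Theta p q) → E (Theta.tail₁ θ) ≡ E (Theta.tail₂ θ)
    tails-agree θ with equal-or-theta tail₁ tail₂ unique₁ unique₂
      where open Theta θ
    ... | inj₁ eq = eq
    ... | inj₂ θ′ = contradiction (fork∈ on-cycle′)
      λ fork∈walk → [ fork∉tail₁ , fork∉tail₂ ]′ (Theta.cycle⊆ θ′ fork∈walk)
      where
      open Theta θ
      cycle′ = Theta.cycle θ′
      on-cycle′ : OnCycle H cycle′ next fork
      on-cycle′ = Equivalence.from (unique cycle′ _ _) (Equivalence.to (unique cycle _ _) (inj₁ fork∈cycle))
      fork∈ : OnCycle H cycle′ next fork → fork ∈ V (Walk.steps (Cycle.walk cycle′))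
      fork∈ = [ proj₂ ∘ traversal-ends cycle′ , proj₁ ∘ traversal-ends cycle′ ]′

    paths-differ-by-cycle : ∀ {i j} (p q : Star Edge i j) → Unique (V p) → Unique (V q) →
      ∃[ stem ] ∃[ side₁ ] ∃[ side₂ ] ∃[ tail ]
        (E p ≡ stem ++ (side₁ ++ tail) × E q ≡ stem ++ (side₂ ++ tail) ×
         (side₁ ++ map swap side₂ ↭ [] ⊎
          side₁ ++ map swap side₂ ↭ traversal C ⊎
          side₁ ++ map swap side₂ ↭ map swap (traversal C)))
    paths-differ-by-cycle p q up uq with equal-or-theta p q up uq
    ... | inj₁ eq = [] , [] , [] , E p , refl , sym eq , inj₁ ↭-refl
    ... | inj₂ θ  = stem , side₁ , side₂ , E tail₁ , edges₁ ,
      trans edges₂ (cong (λ es → stem ++ (side₂ ++ es)) (sym (tails-agree θ))) ,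
      inj₂ (Sum.map (↭-trans sides) (↭-trans sides) (sameCycle⇒traversal-↭ cycle C (unique cycle)))
      where open Theta θ

module Weights {n : ℕ} (G : WeightedOrientedGraph n) where
  open WeightedOrientedGraph G
  open Paths underlying
  open CommutativeMonoid *ᶜ-1-commutativeMonoid using (commutativeSemigroup; assoc; comm; ∙-congˡ; ∙-congʳ)
  open CommutativeSemigroupProperties commutativeSemigroup using (interchange; x∙yz≈xz∙y; x∙yz≈y∙xz)
  open ≈-Reasoning (CommutativeMonoid.setoid *ᶜ-1-commutativeMonoid)

  edgesWeight : List (Fin n × Fin n) → ℂ
  edgesWeight []             = 1ᶜ
  edgesWeight ((u , v) ∷ es) = a G u v *ᶜ edgesWeight es

  stepsWeight≡edgesWeight : ∀ {i j} (es : Star Edge i j) → stepsWeight G es ≡ edgesWeight (E es)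
  stepsWeight≡edgesWeight ε        = refl
  stepsWeight≡edgesWeight (_ ◅ es) = cong (a G _ _ *ᶜ_) (stepsWeight≡edgesWeight es)

  edgesWeight-nonzero : ∀ {es} → All (uncurry Edge) es → Nonzero (edgesWeight es)
  edgesWeight-nonzero []                     = 1ᶜ-nonzero
  edgesWeight-nonzero {(u , v) ∷ es} (e ∷ p) =
    *ᶜ-nonzero (a G u v) (edgesWeight es) (a-nonzero G e) (edgesWeight-nonzero p)

  edgesWeight-++ : ∀ es fs → edgesWeight (es ++ fs) ≈ᶜ edgesWeight es *ᶜ edgesWeight fs
  edgesWeight-++ []             fs = ≈ᶜ-sym (*ᶜ-identityˡ (edgesWeight fs))
  edgesWeight-++ ((u , v) ∷ es) fs = ≈ᶜ-trans (∙-congˡ (edgesWeight-++ es fs))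
    (≈ᶜ-sym (assoc (a G u v) (edgesWeight es) (edgesWeight fs)))

  edgesWeight-↭ : ∀ {es fs} → es ↭ fs → edgesWeight es ≈ᶜ edgesWeight fs
  edgesWeight-↭ ↭.refl                                      = ≈ᶜ-refl
  edgesWeight-↭ (↭.prep _ p)                                = ∙-congˡ (edgesWeight-↭ p)
  edgesWeight-↭ {es = _ ∷ _ ∷ es} (↭.swap (u , v) (w , x) p) = ≈ᶜ-trans
    (x∙yz≈y∙xz (a G u v) (a G w x) (edgesWeight es)) (∙-congˡ (∙-congˡ (edgesWeight-↭ p)))
  edgesWeight-↭ (↭.trans p q)                               = ≈ᶜ-trans (edgesWeight-↭ p) (edgesWeight-↭ q)

  entry-conj : ∀ {u v} (p : Dec (Arc u v)) (q : Dec (Arc v u)) → entry G q p ≈ᶜ conj (entry G p q)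
  entry-conj         (yes p) (yes q) = contradiction q (arc-asym p)
  entry-conj         (yes _) (no _)  = ≈ᶜ-refl
  entry-conj {u} {v} (no _)  (yes _) = conj-involutive (weight v u)
  entry-conj         (no _)  (no _)  = pointwise-≡⇒≈ᶜ (λ _ → refl) (λ _ → refl)

  edgesWeight-swap : ∀ es → edgesWeight (map swap es) ≈ᶜ conj (edgesWeight es)
  edgesWeight-swap []             = pointwise-≡⇒≈ᶜ (λ _ → refl) (λ _ → refl)
  edgesWeight-swap ((u , v) ∷ es) = ≈ᶜ-trans
    (*ᶜ-cong (entry-conj (arc? u v) (arc? v u)) (edgesWeight-swap es))
    (≈ᶜ-sym (conj-*ᶜ (a G u v) (edgesWeight es)))

  edgesWeight-traversal : ∀ C → edgesWeight (traversal C) ≈ᶜ wtCycle G C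
  edgesWeight-traversal C = begin
    a G end base *ᶜ edgesWeight (E steps)  ≡⟨ cong (a G end base *ᶜ_) (stepsWeight≡edgesWeight steps) ⟨
    a G end base *ᶜ wt G walk              ≈⟨ comm (a G end base) (wt G walk) ⟩
    wt G walk *ᶜ a G end base              ∎
    where
    open Cycle C
    open Walk walk using (steps)

  edgesWeight-stem-tail : ∀ stem side tail → edgesWeight (stem ++ (side ++ tail)) ≈ᶜ
    (edgesWeight stem *ᶜ edgesWeight tail) *ᶜ edgesWeight side
  edgesWeight-stem-tail stem side tail = begin
    edgesWeight (stem ++ (side ++ tail))                              ≈⟨ edgesWeight-++ stem (side ++ tail) ⟩
    edgesWeight stem *ᶜ edgesWeight (side ++ tail)                    ≈⟨ ∙-congˡ (edgesWeight-++ side tail) ⟩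
    edgesWeight stem *ᶜ (edgesWeight side *ᶜ edgesWeight tail)
      ≈⟨ x∙yz≈xz∙y (edgesWeight stem) (edgesWeight side) (edgesWeight tail) ⟩
    (edgesWeight stem *ᶜ edgesWeight tail) *ᶜ edgesWeight side        ∎

  common-factor : ∀ {z w} x b d → z ≈ᶜ x *ᶜ edgesWeight b → w ≈ᶜ x *ᶜ edgesWeight d →
    z *ᶜ conj w ≈ᶜ (x *ᶜ conj x) *ᶜ edgesWeight (b ++ map swap d)
  common-factor {z} {w} x b d z≈ w≈ = begin
    z *ᶜ conj w
      ≈⟨ *ᶜ-cong z≈ (≈ᶜ-trans (conj-cong w≈) (conj-*ᶜ x (edgesWeight d))) ⟩
    (x *ᶜ edgesWeight b) *ᶜ (conj x *ᶜ conj (edgesWeight d))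
      ≈⟨ interchange x (edgesWeight b) (conj x) (conj (edgesWeight d)) ⟩
    (x *ᶜ conj x) *ᶜ (edgesWeight b *ᶜ conj (edgesWeight d))
      ≈⟨ ∙-congˡ (∙-congˡ (edgesWeight-swap d)) ⟨
    (x *ᶜ conj x) *ᶜ (edgesWeight b *ᶜ edgesWeight (map swap d))
      ≈⟨ ∙-congˡ (edgesWeight-++ b (map swap d)) ⟨
    (x *ᶜ conj x) *ᶜ edgesWeight (b ++ map swap d) ∎

  not-opposite : ∀ (U : Unicyclic underlying) {i j} (γ′ γ : Walk underlying i j) →
    ¬ NegativeReal (wtCycle G (Unicyclic.cycle U)) → ¬ NegativeReal (wt G γ′ *ᶜ conj (wt G γ))
  not-opposite U γ′ γ wtC≮0 neg
    with paths-differ-by-cycle U (Walk.steps γ′) (Walk.steps γ) (Walk.distinct γ′) (Walk.distinct γ)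
  ... | stem , side₁ , side₂ , tail , eq₁ , eq₂ , sides = [ equal , [ same , reversed ]′ ]′ sides
    where
    C = Unicyclic.cycle U
    x = edgesWeight stem *ᶜ edgesWeight tail
    sidesWeight = edgesWeight (side₁ ++ map swap side₂)

    edges-ok : All (uncurry Edge) (stem ++ (side₁ ++ tail))
    edges-ok = subst (All (uncurry Edge)) eq₁ (edges-Edge (Walk.steps γ′))

    x≠0 : Nonzero x
    x≠0 = *ᶜ-nonzero (edgesWeight stem) (edgesWeight tail)
      (edgesWeight-nonzero (All.++⁻ˡ stem edges-ok))
      (edgesWeight-nonzero (All.++⁻ʳ side₁ (All.++⁻ʳ stem edges-ok)))

    factor : ∀ (δ : Walk underlying _ _) side → E (Walk.steps δ) ≡ stem ++ (side ++ tail) →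
      wt G δ ≈ᶜ x *ᶜ edgesWeight side
    factor δ side eq = subst (_≈ᶜ x *ᶜ edgesWeight side)
      (sym (trans (stepsWeight≡edgesWeight (Walk.steps δ)) (cong edgesWeight eq)))
      (edgesWeight-stem-tail stem side tail)

    sides<0 : NegativeReal sidesWeight
    sides<0 = NegativeReal-cancel x sidesWeight x≠0 (NegativeReal-resp-≈
      (common-factor x side₁ side₂ (factor γ′ side₁ eq₁) (factor γ side₂ eq₂)) neg)

    equal    = λ p → 1ᶜ-notNegativeReal (NegativeReal-resp-≈ (edgesWeight-↭ p) sides<0)
    same     = λ p → wtC≮0 (NegativeReal-resp-≈
      (≈ᶜ-trans (edgesWeight-↭ p) (edgesWeight-traversal C)) sides<0)
    reversed = λ p → wtC≮0 (NegativeReal-resp-≈ (edgesWeight-traversal C) (NegativeReal-conj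
      (NegativeReal-resp-≈ (≈ᶜ-trans (edgesWeight-↭ p) (edgesWeight-swap (traversal C))) sides<0)))

lemma3p6 : (n : ℕ) → 2 ℕ.≤ n →
    (G : WeightedOrientedGraph n) →
    (let open WeightedOrientedGraph G) →
    (U : Unicyclic underlying) →
    (∀ {u v} → Arc u v → ¬ NegativeReal (weight u v)) →
    (i j : Fin n) (γ′ γ : Walk underlying i j) →
    ¬ NegativeReal (wtCycle G (Unicyclic.cycle U)) →
    ¬ (direction (wt G γ′) (wt-nonzero G γ′) ≈ᶜ -ᶜ direction (wt G γ) (wt-nonzero G γ))
lemma3p6 n _ G U _ i j γ′ γ wtC≮0 opposite = Weights.not-opposite G U γ′ γ wtC≮0
  (opposite-directions (wt G γ′) (wt G γ) (wt-nonzero G γ′) (wt-nonzero G γ) opposite)
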